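{- Let $\Gamma$ be a constraint language which (1) is asymptotically sparse, (2) is closed under branching, and (3) contains only non-trivial relations. Then $\mathrm{SAT}(\Gamma)$ is sparsely enumerable.
   Context: A logical relation of arity $k$ is $R\subseteq\{0,1\}^k$; a constraint language is a set of such relations; $\mathrm{SAT}(\Gamma)$ instances are conjunctions of constraints $R(x_1,\dots,x_k)$, $R\in\Gamma$, with relations represented by listing their tuples. $\mathrm{SAT}(\Gamma)$ is sparsely enumerable if there is $c<2$ such that for every instance $\varphi$ on $n$ variables all models of $\varphi$ can be enumerated in time $O^*(c^n)$ (polynomial factors suppressed). $\Gamma$ is asymptotically sparse if there exist $r_0\ge 1$ and $c<2$ such that every $R\in\Gamma$ of arity $r\ge r_0$ satisfies $|R|\le c^r$. For an $n$-ary $R$ and $g\colon[m]\to[n]$ ($m\le n$), the relation $R_g(x_1,\dots,x_m)\equiv R(x_{g(1)},\dots,x_{g(m)})$ is a minor of $R$; $\mathrm{Min}(\Gamma)$ is the set of all minors of relations in $\Gamma$. For $k$-ary $R$ and $f\colon X\to\{0,1\}$ with $X\subseteq[k]$, the substitution $R_{|f}$ is the $(k-|X|)$-ary relation obtained from the tuples $(c_1,\dots,c_k)\in R$ with $c_i=f(i)$ for all $i\in X$ by deleting the coordinates in $X$. $\Gamma$ is closed under branching if $R_{|f}\in\Gamma$ for every $R\in\Gamma$ and every such $f$, and $\mathrm{Min}(\Gamma)=\Gamma$. A relation $R\subseteq\{0,1\}^k$ is non-trivial if $R\neq\{0,1\}^k$. -}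

module Defs where

open import Data.Bool using (Bool; true; false; _∧_)
open import Data.Bool.Properties using () renaming (_≟_ to _≟ᵇ_)
open import Data.Fin using (Fin; toℕ) renaming (zero to fzero)
open import Data.List using (List; []; _∷_; _++_; map; filterᵇ; length)
open import Data.List.Membership.Propositional using (_∈_)
open import Data.List.Relation.Binary.Permutation.Propositional using (_↭_)
open import Data.List.Relation.Unary.All using (All)
open import Data.List.Relation.Unary.Any using (Any)
open import Data.List.Relation.Unary.Unique.Propositional using (Unique)
open import Data.Maybe using (Maybe; just; nothing)
open import Data.Nat using (ℕ; zero; suc; _+_; _*_; _^_; _≤_; _<_; NonZero)
open import Data.Product using (Σ; ∃; _×_)
open import Data.Vec as Vec using (Vec; []; _∷_; lookup; tabulate; replicate; _[_]≔_)
open import Data.Vec.Membership.Propositional using () renaming (_∈_ to _∈ᵥ_)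
open import Data.Vec.Properties using (≡-dec)
open import Function using (Surjective; _⇔_)
open import Level using (Level) renaming (suc to lsuc)
open import Relation.Binary.PropositionalEquality using (_≡_; _≗_)
open import Relation.Nullary using (¬_; does)
import Data.List.Membership.DecPropositional as DecMembership

------------------------------------------------------------------------
-- Logical relations

-- R ⊆ {0,1}^k as its characteristic function; _≗_ is equality of relations.
Rel : ℕ → Set
Rel k = Vec Bool k → Bool

cube : (k : ℕ) → List (Vec Bool k)
cube zero    = [] ∷ []
cube (suc k) = map (false ∷_) (cube k) ++ map (true ∷_) (cube k)

tuples : {k : ℕ} → Rel k → List (Vec Bool k)
tuples {k} R = filterᵇ R (cube k)

∣_∣ : {k : ℕ} → Rel k → ℕ
∣ R ∣ = length (tuples R)

NonTrivial : {k : ℕ} → Rel k → Set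
NonTrivial R = ¬ (∀ t → R t ≡ true)

minor : {n m : ℕ} → Rel n → (Fin n → Fin m) → Rel m
minor R g x = R (tabulate λ i → lookup x (g i))

-- f : X → {0,1} with X ⊆ [k]; the i-th entry is nothing iff i ∉ X.
Partial : ℕ → Set
Partial k = Vec (Maybe Bool) k

-- k ∸ |X|
free : {k : ℕ} → Partial k → ℕ
free []            = 0
free (nothing ∷ f) = suc (free f)
free (just _ ∷ f)  = free f

agrees : {k : ℕ} → Partial k → Vec Bool k → Bool
agrees []            []      = true
agrees (nothing ∷ f) (_ ∷ c) = agrees f c
agrees (just b ∷ f)  (x ∷ c) = does (x ≟ᵇ b) ∧ agrees f c

delete : {k : ℕ} (f : Partial k) → Vec Bool k → Vec Bool (free f)
delete []            []      = []
delete (nothing ∷ f) (x ∷ c) = x ∷ delete f c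
delete (just _ ∷ f)  (_ ∷ c) = delete f c

substitution : {k : ℕ} → Rel k → (f : Partial k) → Rel (free f)
substitution R f t =
  does (t ∈? map (delete f) (filterᵇ (agrees f) (tuples R)))
  where open DecMembership (≡-dec _≟ᵇ_) using (_∈?_)

------------------------------------------------------------------------
-- Constraint languages

record ConstraintLanguage (ℓ : Level) : Set (lsuc ℓ) where
  field
    Contains : {k : ℕ} → Rel k → Set ℓ
    respects : {k : ℕ} {R S : Rel k} → R ≗ S → Contains R → Contains S

open ConstraintLanguage public

-- Throughout, a base c < 2 is a fraction p / q with p < 2 * q, and
-- inequalities involving c ^ n are multiplied by q ^ n. Since c occurs only
-- as an existentially quantified upper bound, rational c are as general as
-- real c.

AsymptoticallySparse : {ℓ : Level} → ConstraintLanguage ℓ → Set ℓ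
AsymptoticallySparse Γ =
  Σ ℕ λ r₀ → Σ ℕ λ p → Σ ℕ λ q →
    1 ≤ r₀ × p < 2 * q ×
    (∀ {r} (R : Rel r) → Contains Γ R → r₀ ≤ r → ∣ R ∣ * q ^ r ≤ p ^ r)

-- Minors identify and permute arguments: g is onto (hence m ≤ n). A g that
-- is not onto would instead add fictitious arguments, and then closure under
-- branching would be incompatible with non-triviality for every non-empty
-- relation of arity ≥ 3.
Min : {ℓ : Level} → ConstraintLanguage ℓ → {m : ℕ} → Rel m → Set ℓ
Min Γ {m} S =
  Σ ℕ λ n → Σ (Rel n) λ R → Σ (Fin n → Fin m) λ g →
    Contains Γ R × Surjective _≡_ _≡_ g × S ≗ minor R g

-- Substitutions leave at least one argument: X = [k] would turn every
-- non-empty R into the trivial nullary relation {0,1}^0.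
ClosedUnderBranching : {ℓ : Level} → ConstraintLanguage ℓ → Set ℓ
ClosedUnderBranching Γ =
  (∀ {k} (R : Rel k) (f : Partial k) →
     Contains Γ R → NonZero (free f) → Contains Γ (substitution R f)) ×
  (∀ {m} (S : Rel m) → Min Γ S ⇔ Contains Γ S)

OnlyNonTrivial : {ℓ : Level} → ConstraintLanguage ℓ → Set ℓ
OnlyNonTrivial Γ = ∀ {k} (R : Rel k) → Contains Γ R → NonTrivial R

------------------------------------------------------------------------
-- SAT(Γ)

record Constraint {ℓ : Level} (Γ : ConstraintLanguage ℓ) (n : ℕ) : Set ℓ where
  field
    {arity}  : ℕ
    relation : Rel arity
    allowed  : Contains Γ relation
    scope    : Vec (Fin n) arity
    -- The tuples of the relation, in the order in which the input gives them.
    listing  : List (Vec Bool arity)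
    lists    : listing ↭ tuples relation

open Constraint public

-- The variables of a conjunction of constraints are those occurring in it.
record Instance {ℓ : Level} (Γ : ConstraintLanguage ℓ) (n : ℕ) : Set ℓ where
  field
    constraints : List (Constraint Γ n)
    occurs      : (x : Fin n) → Any (λ C → x ∈ᵥ scope C) constraints

open Instance public

_⊨_ : {ℓ : Level} {Γ : ConstraintLanguage ℓ} {n : ℕ} →
      Vec Bool n → Instance Γ n → Set ℓ
a ⊨ φ = All (λ C → relation C (Vec.map (lookup a) (scope C)) ≡ true) (constraints φ)

------------------------------------------------------------------------
-- Model of computation: Jones's WHILE language over binary trees, with its
-- usual time measure (one unit per operation). Trees are handled through
-- pointers, so up to factors logarithmic in the running time this is
-- logarithmic-cost RAM time, and O*(c^n) has the same meaning for both.
-- (This would fail for a model that is only polynomially equivalent.)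

data Tree : Set where
  nil : Tree
  _∙_ : Tree → Tree → Tree

infixr 5 _∙_

size : Tree → ℕ
size nil     = 1
size (s ∙ t) = suc (size s + size t)

head tail : Tree → Tree
head nil     = nil
head (s ∙ _) = s
tail nil     = nil
tail (_ ∙ t) = t

Store : ℕ → Set
Store v = Vec Tree v

data Expr (v : ℕ) : Set where
  var   : Fin v → Expr v
  nil   : Expr v
  cons  : Expr v → Expr v → Expr v
  hd tl : Expr v → Expr v

eval : {v : ℕ} → Expr v → Store v → Tree
eval (var x)    σ = lookup σ x
eval nil        σ = nil
eval (cons d e) σ = eval d σ ∙ eval e σ
eval (hd e)     σ = head (eval e σ)
eval (tl e)     σ = tail (eval e σ)

cost : {v : ℕ} → Expr v → ℕ
cost (var x)    = 1
cost nil        = 1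
cost (cons d e) = suc (cost d + cost e)
cost (hd e)     = suc (cost e)
cost (tl e)     = suc (cost e)

data Command (v : ℕ) : Set where
  _≔_           : Fin v → Expr v → Command v
  _⨾_           : Command v → Command v → Command v
  if_then_else_ : Expr v → Command v → Command v → Command v
  while_loop_   : Expr v → Command v → Command v

infix  6 _≔_
infixr 4 _⨾_
infix  5 if_then_else_ while_loop_

-- ⟨ C , σ ⟩⇓ τ [ t ]: started in σ, C halts after t units of time with
-- final store τ. A test succeeds iff its value is not nil.
data ⟨_,_⟩⇓_[_] {v : ℕ} : Command v → Store v → Store v → ℕ → Set where
  assign : ∀ {x e σ} →
           ⟨ x ≔ e , σ ⟩⇓ (σ [ x ]≔ eval e σ) [ suc (cost e) ]
  seq    : ∀ {C D σ τ ρ s t} →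
           ⟨ C , σ ⟩⇓ τ [ s ] → ⟨ D , τ ⟩⇓ ρ [ t ] →
           ⟨ C ⨾ D , σ ⟩⇓ ρ [ suc (s + t) ]
  if-yes : ∀ {e C D σ τ t l r} →
           eval e σ ≡ l ∙ r → ⟨ C , σ ⟩⇓ τ [ t ] →
           ⟨ if e then C else D , σ ⟩⇓ τ [ suc (cost e + t) ]
  if-no  : ∀ {e C D σ τ t} →
           eval e σ ≡ nil → ⟨ D , σ ⟩⇓ τ [ t ] →
           ⟨ if e then C else D , σ ⟩⇓ τ [ suc (cost e + t) ]
  again  : ∀ {e C σ τ ρ s t l r} →
           eval e σ ≡ l ∙ r → ⟨ C , σ ⟩⇓ τ [ s ] → ⟨ while e loop C , τ ⟩⇓ ρ [ t ] →
           ⟨ while e loop C , σ ⟩⇓ ρ [ suc (cost e + (s + t)) ]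
  exit   : ∀ {e C σ} →
           eval e σ ≡ nil →
           ⟨ while e loop C , σ ⟩⇓ σ [ suc (cost e) ]

-- Input and output are in variable 0; all other variables start as nil.
record Program : Set where
  constructor program
  field
    {extra} : ℕ
    body    : Command (suc extra)

Computes_from_to_inTime_ : Program → Tree → Tree → ℕ → Set
Computes program {v} C from input to output inTime t =
  ∃ λ τ → (⟨ C , input ∷ replicate v nil ⟩⇓ τ [ t ]) × lookup τ fzero ≡ output

------------------------------------------------------------------------
-- Encoding of instances and of lists of models

encodeBool : Bool → Tree
encodeBool false = nil
encodeBool true  = nil ∙ nil

-- Unary; as all n variables occur in an instance, this affects its size only
-- polynomially.
encodeℕ : ℕ → Tree
encodeℕ zero    = nil
encodeℕ (suc n) = nil ∙ encodeℕ n

encodeList : {a : Level} {A : Set a} → (A → Tree) → List A → Tree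
encodeList enc []       = nil
encodeList enc (x ∷ xs) = enc x ∙ encodeList enc xs

encodeVec : {A : Set} {n : ℕ} → (A → Tree) → Vec A n → Tree
encodeVec enc xs = encodeList enc (Vec.toList xs)

encodeConstraint : {ℓ : Level} {Γ : ConstraintLanguage ℓ} {n : ℕ} →
                   Constraint Γ n → Tree
encodeConstraint C =
  encodeVec (λ x → encodeℕ (toℕ x)) (scope C) ∙
  encodeList (encodeVec encodeBool) (listing C)

encodeInstance : {ℓ : Level} {Γ : ConstraintLanguage ℓ} {n : ℕ} →
                 Instance Γ n → Tree
encodeInstance {n = n} φ = encodeℕ n ∙ encodeList encodeConstraint (constraints φ)

encodeModels : {n : ℕ} → List (Vec Bool n) → Tree
encodeModels = encodeList (encodeVec encodeBool)

------------------------------------------------------------------------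
-- Sparse enumerability

-- The time bound is t ≤ a · |φ|^d · c^n, with |φ| the size of the encoded
-- instance.
SparselyEnumerable : {ℓ : Level} → ConstraintLanguage ℓ → Set ℓ
SparselyEnumerable Γ =
  Σ ℕ λ p → Σ ℕ λ q → p < 2 * q ×
  Σ Program λ P → Σ ℕ λ a → Σ ℕ λ d →
    ∀ {n} (φ : Instance Γ n) →
      Σ (List (Vec Bool n)) λ models → Σ ℕ λ t →
        Unique models ×
        (∀ m → m ∈ models ⇔ m ⊨ φ) ×
        Computes P from encodeInstance φ to encodeModels models inTime t ×
        t * q ^ n ≤ a * size (encodeInstance φ) ^ d * p ^ n

{-# OPTIONS --safe #-}

-- The models are enumerated by an iterated join: keep the list of all partial
-- assignments to the variables V of the constraints treated so far that satisfy
-- these constraints, and for the next constraint try to extend each of them by each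
-- listed tuple. Fix such an assignment, and let m ≥ 1 be the number of new variables.
-- Its extensions correspond to the tuples of the relation obtained from the
-- constraint by substituting the assigned variables and identifying repeated ones.
-- This relation is m-ary and in Γ, hence has at most c ^ m tuples for m ≥ r₀ and at
-- most 2 ^ m - 1 otherwise, so at most C ^ m for a single C < 2. Hence the list never
-- has more than C ^ |V| entries, and since every variable occurs in some constraint,
-- its final entries are total.

module Submission where

open import Data.Bool using (Bool; true; false; not)
open import Data.Bool.Properties using (T-≡; T?) renaming (_≟_ to _≟ᵇ_)
open import Data.Empty using (⊥-elim)
open import Data.Fin using (Fin; zero; suc; toℕ)
open import Data.Fin.Properties using (injective⇒≤; toℕ<n) renaming (_≟_ to _≟ᶠ_)
open import Data.List as List using (List; []; _∷_; _++_; _ʳ++_; length; mapMaybe; concatMap; deduplicate; filter)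
import Data.List.Membership.DecPropositional as DecMembership
open import Data.List.Membership.Propositional using (_∈_; _∉_; find; lose)
open import Data.List.Membership.Propositional.Properties as ∈ₚ using (∈-lookup)
open import Data.List.Properties using (length-++; length-map; length-filter; ++-ʳ++; ʳ++-ʳ++; length-ʳ++)
open import Data.List.Relation.Binary.Permutation.Propositional using (_↭_; ↭-sym; ↭⇒↭ₛ)
open import Data.List.Relation.Binary.Permutation.Propositional.Properties using (↭-reverse; ∈-resp-↭; ↭-length)
import Data.List.Relation.Binary.Permutation.Setoid.Properties as ↭ₛ
open import Data.List.Relation.Unary.All as All using (All; []; _∷_)
open import Data.List.Relation.Unary.AllPairs using ([]; _∷_)
open import Data.List.Relation.Unary.Any as Any using (here; there)
open import Data.List.Relation.Unary.Any.Properties using (lookup-index; reverseAcc⁺; reverseAcc⁻)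
open import Data.List.Relation.Unary.Unique.DecPropositional.Properties using (deduplicate-!)
open import Data.List.Relation.Unary.Unique.Propositional using (Unique)
import Data.List.Relation.Unary.Unique.Propositional.Properties as Uniqueₚ
open import Data.Maybe using (Maybe; just; nothing; _>>=_; fromMaybe)
open import Data.Maybe.Properties using (just-injective)
open import Data.Nat using (ℕ; zero; suc; _+_; _*_; _∸_; _^_; _≤_; _<_; z≤n; s≤s; NonZero; >-nonZero)
open import Data.Nat.Properties
open import Data.Nat.Solver using (module +-*-Solver)
open import Data.Product using (Σ; ∃; _×_; _,_; proj₁; proj₂)
open import Data.Sum using (_⊎_; inj₁; inj₂; fromInj₂)
open import Data.Vec as Vec using (Vec; []; _∷_; lookup; tabulate; _[_]≔_)
open import Data.Vec.Properties using (≡-dec; []≔-lookup; length-toList; lookup∘update; lookup∘update′; lookup-map; lookup-replicate; lookup∘tabulate; tabulate∘lookup; tabulate-cong)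
import Data.Vec.Relation.Unary.Any as VecAny
import Data.Vec.Relation.Unary.Any.Properties as VecAnyₚ
open import Function using (_∘_; _⇔_; mk⇔; Equivalence)
open import Level using (Level)
open import Relation.Binary.PropositionalEquality
open import Relation.Nullary using (¬_; yes; no; contradiction)
open import Relation.Nullary.Decidable using (dec-true; ¬?)

open import Defs

private variable
  a b : Level
  A : Set a
  B : Set b
  k n : ℕ

-- Counting in lists without repetitions

lookup-injective : {xs : List A} → Unique xs → ∀ {i j} →
                   List.lookup xs i ≡ List.lookup xs j → i ≡ j
lookup-injective (_   ∷ _)  {zero}  {zero}  _  = refl
lookup-injective (x∉ ∷ _)   {zero}  {suc j} eq = ⊥-elim (All.lookup x∉ (∈-lookup j) eq)
lookup-injective (x∉ ∷ _)   {suc i} {zero}  eq = ⊥-elim (All.lookup x∉ (∈-lookup i) (sym eq))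
lookup-injective (_  ∷ xs!) {suc i} {suc j} eq = cong suc (lookup-injective xs! eq)

-- Each position in `xs` is sent to the position of its image in `ys`. Equal target positions give
-- equal images, hence equal entries, hence equal source positions.
length-≤-injection : {xs : List A} {ys : List B} (f : A → B) → Unique xs →
                     (∀ {x} → x ∈ xs → f x ∈ ys) →
                     (∀ {x y} → x ∈ xs → y ∈ xs → f x ≡ f y → x ≡ y) →
                     length xs ≤ length ys
length-≤-injection {xs = xs} {ys} f xs! f∈ inj = injective⇒≤ {f = to} to-injective
  where
  to : Fin (length xs) → Fin (length ys)
  to i = Any.index (f∈ (∈-lookup i))

  to-injective : ∀ {i j} → to i ≡ to j → i ≡ j
  to-injective {i} {j} eq = lookup-injective xs! (inj (∈-lookup i) (∈-lookup j)
    (trans (lookup-index (f∈ (∈-lookup i)))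
    (trans (cong (List.lookup ys) eq) (sym (lookup-index (f∈ (∈-lookup j)))))))

∈-mapMaybe⁺ : (f : A → Maybe B) {xs : List A} {x : A} {y : B} →
              x ∈ xs → f x ≡ just y → y ∈ mapMaybe f xs
∈-mapMaybe⁺ f {x ∷ _} (here refl) eq with f x | eq
... | just _ | refl = here refl
∈-mapMaybe⁺ f {x ∷ _} (there x∈) eq with f x
... | just _  = there (∈-mapMaybe⁺ f x∈ eq)
... | nothing = ∈-mapMaybe⁺ f x∈ eq

∈-mapMaybe⁻ : (f : A → Maybe B) (xs : List A) {y : B} →
              y ∈ mapMaybe f xs → ∃ λ x → x ∈ xs × f x ≡ just y
∈-mapMaybe⁻ f (x ∷ xs) y∈ with f x in eq
∈-mapMaybe⁻ f (x ∷ xs) (here refl) | just _ = x , here refl , eq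
∈-mapMaybe⁻ f (x ∷ xs) (there y∈) | just _ =
  let z , z∈ , eq′ = ∈-mapMaybe⁻ f xs y∈ in z , there z∈ , eq′
∈-mapMaybe⁻ f (x ∷ xs) y∈ | nothing =
  let z , z∈ , eq′ = ∈-mapMaybe⁻ f xs y∈ in z , there z∈ , eq′

mapMaybe-unique : (f : A → Maybe B) → (∀ {x y z} → f x ≡ just z → f y ≡ just z → x ≡ y) →
                  {xs : List A} → Unique xs → Unique (mapMaybe f xs)
mapMaybe-unique f inj {[]} [] = []
mapMaybe-unique f inj {x ∷ xs} (x∉ ∷ xs!) with f x in eq
... | nothing = mapMaybe-unique f inj xs!
... | just z  = All.tabulate fresh ∷ mapMaybe-unique f inj xs!
  where
  fresh : ∀ {y} → y ∈ mapMaybe f xs → z ≢ y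
  fresh y∈ refl = let x′ , x′∈ , eq′ = ∈-mapMaybe⁻ f xs y∈ in
    All.lookup x∉ x′∈ (inj eq eq′)

concatMap-unique : (f : A → List B) (xs : List A) → Unique xs →
                   (∀ {x} → x ∈ xs → Unique (f x)) →
                   (∀ {x y z} → x ∈ xs → y ∈ xs → z ∈ f x → z ∈ f y → x ≡ y) →
                   Unique (concatMap f xs)
concatMap-unique f []       []         _  _   = []
concatMap-unique f (x ∷ xs) (x∉ ∷ xs!) f! inj =
  Uniqueₚ.++⁺ (f! (here refl))
    (concatMap-unique f xs xs! (f! ∘ there) (λ x∈ y∈ → inj (there x∈) (there y∈)))
    λ (z∈x , z∈xs) → let y , y∈ , z∈y = find (∈ₚ.∈-concatMap⁻ f {xs = xs} z∈xs) in
      All.lookup x∉ y∈ (inj (here refl) (there y∈) z∈x z∈y)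

-- The cross-multiplied form is the one needed for a rational base: `q` and `p` will be `Q ^ m` and
-- `P ^ m`.
length-concatMap-≤ : ∀ (f : A → List B) (xs : List A) {q p} →
                     (∀ {x} → x ∈ xs → length (f x) * q ≤ p) →
                     length (concatMap f xs) * q ≤ length xs * p
length-concatMap-≤ f []       _ = z≤n
length-concatMap-≤ f (x ∷ xs) {q} {p} h = begin
  length (f x ++ concatMap f xs) * q               ≡⟨ cong (_* q) (length-++ (f x)) ⟩
  (length (f x) + length (concatMap f xs)) * q     ≡⟨ *-distribʳ-+ q (length (f x)) _ ⟩
  length (f x) * q + length (concatMap f xs) * q   ≤⟨ +-mono-≤ (h (here refl)) (length-concatMap-≤ f xs (h ∘ there)) ⟩
  p + length xs * p                                ∎
  where open ≤-Reasoning

-- Relations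

∈-cube : (t : Vec Bool k) → t ∈ cube k
∈-cube []          = here refl
∈-cube (false ∷ t) = ∈ₚ.∈-++⁺ˡ (∈ₚ.∈-map⁺ (false ∷_) (∈-cube t))
∈-cube (true ∷ t)  = ∈ₚ.∈-++⁺ʳ _ (∈ₚ.∈-map⁺ (true ∷_) (∈-cube t))

∈-filterᵇ⁺ : (p : A → Bool) {xs : List A} {x : A} → x ∈ xs → p x ≡ true → x ∈ List.filterᵇ p xs
∈-filterᵇ⁺ p x∈ px = ∈ₚ.∈-filter⁺ _ x∈ (Equivalence.from T-≡ px)

∈-tuples⁺ : {R : Rel k} {t : Vec Bool k} → R t ≡ true → t ∈ tuples R
∈-tuples⁺ {R = R} Rt = ∈-filterᵇ⁺ R (∈-cube _) Rt

∈-tuples⁻ : {R : Rel k} {t : Vec Bool k} → t ∈ tuples R → R t ≡ true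
∈-tuples⁻ {k} {R} t∈ = Equivalence.to T-≡ (proj₂ (∈ₚ.∈-filter⁻ _ {xs = cube k} t∈))

cube-unique : ∀ k → Unique (cube k)
cube-unique zero    = [] ∷ []
cube-unique (suc k) = Uniqueₚ.++⁺ (Uniqueₚ.map⁺ (λ {refl → refl}) (cube-unique k))
  (Uniqueₚ.map⁺ (λ {refl → refl}) (cube-unique k)) disjoint
  where
  disjoint : ∀ {t} → ¬ (t ∈ List.map (false ∷_) (cube k) × t ∈ List.map (true ∷_) (cube k))
  disjoint (p , q) with ∈ₚ.∈-map⁻ _ p | ∈ₚ.∈-map⁻ _ q
  ... | _ , _ , refl | _ , _ , ()

tuples-unique : (R : Rel k) → Unique (tuples R)
tuples-unique {k} R = Uniqueₚ.filter⁺ _ (cube-unique k)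

length-cube : ∀ k → length (cube k) ≡ 2 ^ k
length-cube zero    = refl
length-cube (suc k) = begin
  length (List.map (false ∷_) (cube k) ++ List.map (true ∷_) (cube k))
    ≡⟨ length-++ (List.map (false ∷_) (cube k)) ⟩
  length (List.map (false ∷_) (cube k)) + length (List.map (true ∷_) (cube k))
    ≡⟨ cong₂ _+_ (length-map (false ∷_) (cube k)) (length-map (true ∷_) (cube k)) ⟩
  length (cube k) + length (cube k)
    ≡⟨ cong₂ _+_ (length-cube k) (trans (length-cube k) (sym (+-identityʳ _))) ⟩
  2 ^ suc k ∎
  where open ≡-Reasoning

-- `NonTrivial` supplies no missing tuple. As the cube is finite, the negation passes to its list,
-- where strictness comes from the first tuple that `R` rejects.
nonTrivial⇒∣R∣<2^k : (R : Rel k) → NonTrivial R → ∣ R ∣ < 2 ^ k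
nonTrivial⇒∣R∣<2^k {k} R nt with All.all? (λ t → R t ≟ᵇ true) (cube k)
... | yes all = ⊥-elim (nt λ t → All.lookup all (∈-cube t))
... | no ¬all = subst (∣ R ∣ <_) (length-cube k) (proper (cube k) ¬all)
  where
  proper : (ts : List (Vec Bool k)) → ¬ All (λ t → R t ≡ true) ts → length (List.filterᵇ R ts) < length ts
  proper []       ¬all = ⊥-elim (¬all [])
  proper (t ∷ ts) ¬all with R t in eq
  ... | true  = s≤s (proper ts λ all → ¬all (eq ∷ all))
  ... | false = s≤s (length-filter (T? ∘ R) ts)

-- The sparsity constant

-- The increment from `x ^ m` is bounded by the derivative at the right end point. In the induction
-- step, one factor `suc x` is split into 1 and `x`, and the hypothesis is applied to the part
-- multiplied by `x`.
bernoulli : ∀ x m → suc x ^ m ≤ x ^ m + m * suc x ^ (m ∸ 1)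
bernoulli x zero    = ≤-refl
bernoulli x (suc m) = begin
  suc x ^ m + x * suc x ^ m                   ≤⟨ +-monoʳ-≤ (suc x ^ m) (*-monoʳ-≤ x (bernoulli x m)) ⟩
  suc x ^ m + x * (x ^ m + m * suc x ^ (m ∸ 1)) ≡⟨ cong (suc x ^ m +_) (*-distribˡ-+ x (x ^ m) _) ⟩
  suc x ^ m + (x * x ^ m + x * (m * suc x ^ (m ∸ 1))) ≤⟨ +-monoʳ-≤ (suc x ^ m) (+-monoʳ-≤ (x * x ^ m) (lower m)) ⟩
  suc x ^ m + (x * x ^ m + m * suc x ^ m)     ≡⟨ swap (suc x ^ m) (x * x ^ m) (m * suc x ^ m) ⟩
  x * x ^ m + (suc x ^ m + m * suc x ^ m)     ∎
  where
  open ≤-Reasoning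
  swap : ∀ a b c → a + (b + c) ≡ b + (a + c)
  swap a b c = trans (sym (+-assoc a b c)) (trans (cong (_+ c) (+-comm a b)) (+-assoc b a c))
  -- Enlarging the factor `x` to `suc x` restores the exponent lowered by `∸ 1`; for `m = 0` the
  -- coefficient vanishes.
  lower : ∀ m → x * (m * suc x ^ (m ∸ 1)) ≤ m * suc x ^ m
  lower zero    = ≤-reflexive (*-zeroʳ x)
  lower (suc m) = begin
    x * (suc m * suc x ^ m)       ≡⟨ trans (sym (*-assoc x (suc m) _)) (trans (cong (_* suc x ^ m) (*-comm x (suc m))) (*-assoc (suc m) x _)) ⟩
    suc m * (x * suc x ^ m)       ≤⟨ *-monoʳ-≤ (suc m) (*-monoˡ-≤ (suc x ^ m) (n≤1+n x)) ⟩
    suc m * (suc x * suc x ^ m)   ∎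

^-distribʳ-* : ∀ m x y → (x * y) ^ m ≡ x ^ m * y ^ m
^-distribʳ-* zero    x y = refl
^-distribʳ-* (suc m) x y = trans (cong (x * y *_) (^-distribʳ-* m x y)) ([m*n]*[o*p]≡[m*o]*[n*p] x y (x ^ m) (y ^ m))

-- With x = 2 Q - 1, Bernoulli loses at most (m + 1) (2 Q) ^ m ≤ Q ^ (m + 1).
sparse-small : ∀ Q x m N → 2 * Q ≡ suc x → suc m * 2 ^ m ≤ Q → N < 2 ^ suc m →
               N * Q ^ suc m ≤ x ^ suc m
sparse-small Q x m N 2Q≡ m≤Q N< = +-cancelʳ-≤ (Q ^ suc m) _ _ (begin
  N * Q ^ suc m + Q ^ suc m                  ≡⟨ +-comm (N * Q ^ suc m) _ ⟩
  suc N * Q ^ suc m                          ≤⟨ *-monoˡ-≤ (Q ^ suc m) N< ⟩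
  2 ^ suc m * Q ^ suc m                      ≡⟨ ^-distribʳ-* (suc m) 2 Q ⟨
  (2 * Q) ^ suc m                            ≡⟨ cong (_^ suc m) 2Q≡ ⟩
  suc x ^ suc m                              ≤⟨ bernoulli x (suc m) ⟩
  x ^ suc m + suc m * suc x ^ m              ≡⟨ cong (λ z → x ^ suc m + suc m * z ^ m) 2Q≡ ⟨
  x ^ suc m + suc m * (2 * Q) ^ m            ≡⟨ cong (λ z → x ^ suc m + suc m * z) (^-distribʳ-* m 2 Q) ⟩
  x ^ suc m + suc m * (2 ^ m * Q ^ m)        ≡⟨ cong (x ^ suc m +_) (*-assoc (suc m) (2 ^ m) _) ⟨
  x ^ suc m + suc m * 2 ^ m * Q ^ m          ≤⟨ +-monoʳ-≤ (x ^ suc m) (*-monoˡ-≤ (Q ^ m) m≤Q) ⟩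
  x ^ suc m + Q * Q ^ m                      ∎)
  where open ≤-Reasoning

-- The bases compare as p / q ≤ 2 - 1 / q ≤ 2 - 1 / Q = x / Q, because p < 2 q are integers and q ≤
-- Q. Cleared of denominators this is `pQ≤xq`.
sparse-large : ∀ Q x p q m N → 2 * Q ≡ suc x → p < 2 * q → 1 ≤ q → q ≤ Q →
               N * q ^ m ≤ p ^ m → N * Q ^ m ≤ x ^ m
sparse-large Q x p q m N 2Q≡ p<2q 1≤q q≤Q h = *-cancelʳ-≤ _ _ (q ^ m) {{m^n≢0 q m {{>-nonZero 1≤q}}}} (begin
  N * Q ^ m * q ^ m    ≡⟨ *-assoc N _ _ ⟩
  N * (Q ^ m * q ^ m)  ≡⟨ cong (N *_) (*-comm (Q ^ m) _) ⟩
  N * (q ^ m * Q ^ m)  ≡⟨ *-assoc N _ _ ⟨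
  N * q ^ m * Q ^ m    ≤⟨ *-monoˡ-≤ (Q ^ m) h ⟩
  p ^ m * Q ^ m        ≡⟨ ^-distribʳ-* m p Q ⟨
  (p * Q) ^ m          ≤⟨ ^-monoˡ-≤ m pQ≤xq ⟩
  (x * q) ^ m          ≡⟨ ^-distribʳ-* m x q ⟩
  x ^ m * q ^ m        ∎)
  where
  open ≤-Reasoning
  pQ≤xq : p * Q ≤ x * q
  pQ≤xq = +-cancelˡ-≤ Q _ _ (begin
    Q + p * Q        ≤⟨ *-monoˡ-≤ Q p<2q ⟩
    2 * q * Q        ≡⟨ trans (cong (_* Q) (*-comm 2 q)) (trans (*-assoc q 2 Q) (trans (*-comm q (2 * Q)) (cong (_* q) 2Q≡))) ⟩
    q + x * q        ≤⟨ +-monoˡ-≤ (x * q) q≤Q ⟩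
    Q + x * q        ∎)

-- Nullary relations are left out: closure under branching yields a relation in `Γ` only if an
-- argument remains. Arity 0 is treated directly in `countExtensions`.
UniformlySparse : {ℓ : Level} → ConstraintLanguage ℓ → ℕ → ℕ → Set ℓ
UniformlySparse Γ P Q = ∀ {m} (R : Rel (suc m)) → Contains Γ R → ∣ R ∣ * Q ^ suc m ≤ P ^ suc m

uniformlySparse : {ℓ : Level} (Γ : ConstraintLanguage ℓ) → AsymptoticallySparse Γ → OnlyNonTrivial Γ →
                  Σ ℕ λ P → Σ ℕ λ Q → P < 2 * Q × Q ≤ P × UniformlySparse Γ P Q
uniformlySparse Γ (r₀ , p , q , 1≤r₀ , p<2q , sparse) nonTrivial =
  x , Q , ≤-reflexive (sym 2Q≡) , Q≤x , bound
  where
  -- `Q` exceeds `q`, for the large arities, and `suc m * 2 ^ m` whenever `suc m < r₀`, for the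
  -- small ones. The common base is `x / Q`, that is, 2 - 1 / Q.
  y = r₀ * 2 ^ r₀ + q
  Q = suc y
  x = y + Q
  2Q≡ : 2 * Q ≡ suc x
  2Q≡ = cong (λ z → suc (y + z)) (+-identityʳ Q)
  Q≤x : Q ≤ x
  Q≤x = m≤n+m Q y
  1≤q : ∀ q → p < 2 * q → 1 ≤ q
  1≤q (suc _) _ = s≤s z≤n
  bound : UniformlySparse Γ x Q
  bound {m} R R∈ with r₀ ≤? suc m
  ... | yes r₀≤ = sparse-large Q x p q (suc m) ∣ R ∣ 2Q≡ p<2q (1≤q q p<2q)
                    (≤-trans (m≤n+m q _) (n≤1+n y)) (sparse R R∈ r₀≤)
  ... | no r₀≰ = sparse-small Q x m ∣ R ∣ 2Q≡ small (nonTrivial⇒∣R∣<2^k R (nonTrivial R R∈))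
    where
    m<r₀ : suc m ≤ r₀
    m<r₀ = <⇒≤ (≰⇒> r₀≰)
    small : suc m * 2 ^ m ≤ Q
    small = ≤-trans (*-mono-≤ m<r₀ (^-monoʳ-≤ 2 (≤-trans (n≤1+n m) m<r₀)))
              (≤-trans (m≤m+n _ q) (n≤1+n y))

-- Substitutions

positions : (f : Partial k) → Fin (free f) → Fin k
positions (nothing ∷ f) zero    = zero
positions (nothing ∷ f) (suc i) = suc (positions f i)
positions (just _ ∷ f)  i       = suc (positions f i)

lookup-delete : (f : Partial k) (t : Vec Bool k) (i : Fin (free f)) →
                lookup (delete f t) i ≡ lookup t (positions f i)
lookup-delete (nothing ∷ f) (_ ∷ t) zero    = refl
lookup-delete (nothing ∷ f) (_ ∷ t) (suc i) = lookup-delete f t i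
lookup-delete (just _ ∷ f)  (_ ∷ t) i       = lookup-delete f t i

lookup-positions : (f : Partial k) (i : Fin (free f)) → lookup f (positions f i) ≡ nothing
lookup-positions (nothing ∷ f) zero    = refl
lookup-positions (nothing ∷ f) (suc i) = lookup-positions f i
lookup-positions (just _ ∷ f)  i       = lookup-positions f i

positions-onto : (f : Partial k) (i : Fin k) → lookup f i ≡ nothing → ∃ λ j → positions f j ≡ i
positions-onto (nothing ∷ f) zero    _  = zero , refl
positions-onto (nothing ∷ f) (suc i) eq = let j , eq′ = positions-onto f i eq in suc j , cong suc eq′
positions-onto (just _ ∷ f)  (suc i) eq = let j , eq′ = positions-onto f i eq in j , cong suc eq′

agrees⁺ : (f : Partial k) (t : Vec Bool k) →
          (∀ i {b} → lookup f i ≡ just b → lookup t i ≡ b) → agrees f t ≡ true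
agrees⁺ []            []      _ = refl
agrees⁺ (nothing ∷ f) (_ ∷ t) h = agrees⁺ f t (h ∘ suc)
agrees⁺ (just b ∷ f)  (x ∷ t) h rewrite dec-true (x ≟ᵇ b) (h zero refl) = agrees⁺ f t (h ∘ suc)

substitution⁺ : (R : Rel k) (f : Partial k) (t : Vec Bool k) → R t ≡ true → agrees f t ≡ true →
                substitution R f (delete f t) ≡ true
substitution⁺ R f t Rt agr = dec-true (_ ∈? _)
  (∈ₚ.∈-map⁺ (delete f) (∈-filterᵇ⁺ (agrees f) (∈-tuples⁺ {R = R} Rt) agr))
  where open DecMembership (≡-dec _≟ᵇ_) using (_∈?_)

-- Merging a partial assignment with a tuple

-- The stored entry, which is `lookup a x` in `merge`, is a separate argument so that proofs can
-- split on it.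
bind : Maybe Bool → Partial n → Fin n → Bool → Maybe (Partial n)
bind nothing      a x b     = just (a [ x ]≔ just b)
bind (just false) a x false = just a
bind (just false) a x true  = nothing
bind (just true)  a x false = nothing
bind (just true)  a x true  = just a

merge : Partial n → Vec (Fin n) k → Vec Bool k → Maybe (Partial n)
merge a []       []      = just a
merge a (x ∷ xs) (b ∷ t) = bind (lookup a x) a x b >>= λ a′ → merge a′ xs t

-- `values` and `keeps` determine `a′` from `a`, `xs` and `t`, so that soundness and counting need
-- not look inside `merge`.
record Extends (a : Partial n) (xs : Vec (Fin n) k) (t : Vec Bool k) (a′ : Partial n) : Set where
  field
    extends : ∀ {y c} → lookup a y ≡ just c → lookup a′ y ≡ just c
    values  : ∀ i → lookup a′ (lookup xs i) ≡ just (lookup t i)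
    keeps   : ∀ y → (∃ λ i → lookup xs i ≡ y) ⊎ lookup a′ y ≡ lookup a y

open Extends

bind-extends : (a : Partial n) (x : Fin n) (b : Bool) {a′ : Partial n} →
                 bind (lookup a x) a x b ≡ just a′ → Extends a (x ∷ []) (b ∷ []) a′
bind-extends a x b eq with lookup a x in eqx | b
bind-extends a x _ refl | nothing | b = record
  { extends = λ {y} ay → trans (lookup∘update′ (λ { refl → contradiction (trans (sym eqx) ay) λ () }) a (just b)) ay
  ; values  = λ { zero → lookup∘update x a (just b) }
  ; keeps   = keep
  }
  where
  keep : ∀ y → (∃ λ i → lookup (x ∷ []) i ≡ y) ⊎ lookup (a [ x ]≔ just b) y ≡ lookup a y
  keep y with x ≟ᶠ y
  ... | yes x≡y = inj₁ (zero , x≡y)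
  ... | no x≢y  = inj₂ (lookup∘update′ (x≢y ∘ sym) a (just b))
bind-extends a x b refl | just false | false = record
  { extends = λ ay → ay ; values = λ { zero → eqx } ; keeps = λ _ → inj₂ refl }
bind-extends a x b refl | just true | true = record
  { extends = λ ay → ay ; values = λ { zero → eqx } ; keeps = λ _ → inj₂ refl }

merge-extends : (a : Partial n) (xs : Vec (Fin n) k) (t : Vec Bool k) {a′ : Partial n} →
                merge a xs t ≡ just a′ → Extends a xs t a′
merge-extends a [] [] refl = record
  { extends = λ ay → ay ; values = λ () ; keeps = λ _ → inj₂ refl }
merge-extends a (x ∷ xs) (b ∷ t) {a′} eq with bind (lookup a x) a x b in eqa
... | just a₁ = record
  { extends = extends rest ∘ extends first
  ; values  = λ { zero → extends rest (values first zero) ; (suc i) → values rest i }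
  ; keeps   = keep
  }
  where
  first = bind-extends a x b eqa
  rest  = merge-extends a₁ xs t eq
  keep : ∀ y → (∃ λ i → lookup (x ∷ xs) i ≡ y) ⊎ lookup a′ y ≡ lookup a y
  keep y with keeps rest y | keeps first y
  ... | inj₁ (i , eq) | _                = inj₁ (suc i , eq)
  ... | inj₂ _        | inj₁ (zero , eq) = inj₁ (zero , eq)
  ... | inj₂ eq       | inj₂ eq′         = inj₂ (trans eq eq′)

_⊑_ : Partial n → Vec Bool n → Set
a ⊑ m = ∀ {y c} → lookup a y ≡ just c → lookup m y ≡ c

bind-complete : (a : Partial n) (x : Fin n) (m : Vec Bool n) → a ⊑ m →
                  ∃ λ a′ → bind (lookup a x) a x (lookup m x) ≡ just a′ × a′ ⊑ m
bind-complete a x m a⊑m with lookup a x in eq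
... | nothing = _ , refl , ⊑′
  where
  ⊑′ : (a [ x ]≔ just (lookup m x)) ⊑ m
  ⊑′ {y} eq′ with x ≟ᶠ y
  ... | yes refl = just-injective (trans (sym (lookup∘update x a _)) eq′)
  ... | no x≢y   = a⊑m (trans (sym (lookup∘update′ (x≢y ∘ sym) a _)) eq′)
... | just false rewrite a⊑m eq = a , refl , a⊑m
... | just true  rewrite a⊑m eq = a , refl , a⊑m

-- No clash can arise, because the entries already set and the tuple come from the same total
-- assignment `m`. Hence the join loses no model.
merge-complete : (a : Partial n) (xs : Vec (Fin n) k) (m : Vec Bool n) → a ⊑ m →
                 ∃ λ a′ → merge a xs (Vec.map (lookup m) xs) ≡ just a′ × a′ ⊑ m
merge-complete a []       m a⊑m = a , refl , a⊑m
merge-complete a (x ∷ xs) m a⊑m with bind (lookup a x) a x (lookup m x) | bind-complete a x m a⊑m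
... | just a₁ | _ , refl , a₁⊑m = merge-complete a₁ xs m a₁⊑m

lookup-ext : {u v : Vec A n} → (∀ i → lookup u i ≡ lookup v i) → u ≡ v
lookup-ext {u = u} {v} h = trans (sym (tabulate∘lookup u)) (trans (tabulate-cong h) (tabulate∘lookup v))

-- A disjunction rather than an equivalence, so that each use also decides membership in `V`.
HasDomain : List (Fin n) → Partial n → Set
HasDomain V a = ∀ x → (x ∈ V × ∃ λ b → lookup a x ≡ just b) ⊎ (x ∉ V × lookup a x ≡ nothing)

-- Counting extensions

-- Repetitions are removed because all occurrences of a variable in the scope become a single
-- argument of the residual relation.
newVariables : List (Fin n) → Vec (Fin n) k → List (Fin n)
newVariables V xs = deduplicate _≟ᶠ_ (filter (λ x → ¬? (x ∈? V)) (Vec.toList xs))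
  where open DecMembership _≟ᶠ_ using (_∈?_)

∈-toList⁺ : (xs : Vec A k) (i : Fin k) → lookup xs i ∈ Vec.toList xs
∈-toList⁺ (x ∷ xs) zero    = here refl
∈-toList⁺ (x ∷ xs) (suc i) = there (∈-toList⁺ xs i)

∈-toList⁻ : (xs : Vec A k) {x : A} → x ∈ Vec.toList xs → ∃ λ i → lookup xs i ≡ x
∈-toList⁻ (x ∷ xs) (here refl) = zero , refl
∈-toList⁻ (x ∷ xs) (there x∈)  = let i , eq = ∈-toList⁻ xs x∈ in suc i , eq

module _ {n k : ℕ} (V : List (Fin n)) (xs : Vec (Fin n) k) where
  open DecMembership (_≟ᶠ_ {n}) using (_∈?_)

  newVariables-unique : Unique (newVariables V xs)
  newVariables-unique = deduplicate-! _≟ᶠ_ _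

  ∈-newVariables⁺ : ∀ i → lookup xs i ∉ V → lookup xs i ∈ newVariables V xs
  ∈-newVariables⁺ i ∉V = ∈ₚ.∈-deduplicate⁺ _≟ᶠ_ (∈ₚ.∈-filter⁺ _ (∈-toList⁺ xs i) ∉V)

  ∈-newVariables⁻ : ∀ {x} → x ∈ newVariables V xs → (∃ λ i → lookup xs i ≡ x) × x ∉ V
  ∈-newVariables⁻ x∈ =
    let x∈xs , x∉V = ∈ₚ.∈-filter⁻ (λ x → ¬? (x ∈? V)) {xs = Vec.toList xs} (∈ₚ.∈-deduplicate⁻ _≟ᶠ_ _ x∈)
    in ∈-toList⁻ xs x∈xs , x∉V

merge-domain : {V : List (Fin n)} {a : Partial n} (xs : Vec (Fin n) k) (t : Vec Bool k) {a′ : Partial n} →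
               HasDomain V a → Extends a xs t a′ → HasDomain (newVariables V xs ++ V) a′
merge-domain {V = V} {a} xs t dom ex x with dom x
... | inj₁ (x∈V , b , eq) = inj₁ (∈ₚ.∈-++⁺ʳ _ x∈V , b , extends ex eq)
... | inj₂ (x∉V , eq) with keeps ex x
...   | inj₁ (i , refl) = inj₁ (∈ₚ.∈-++⁺ˡ (∈-newVariables⁺ V xs i x∉V) , _ , values ex i)
-- `keeps` does not exclude that `x` is in the scope; but then `values` would make its entry a
-- `just`, whereas it has stayed `nothing`.
...   | inj₂ eq′ with x ∈? newVariables V xs
  where open DecMembership _≟ᶠ_ using (_∈?_)
...     | yes x∈ with (i , refl) , _ ← ∈-newVariables⁻ V xs x∈ = contradiction (trans (sym (values ex i)) (trans eq′ eq)) λ ()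
...     | no x∉ = inj₂ (x∉′ , trans eq′ eq)
  where
  x∉′ : x ∉ newVariables V xs ++ V
  x∉′ x∈ with ∈ₚ.∈-++⁻ (newVariables V xs) x∈
  ... | inj₁ p = x∉ p
  ... | inj₂ p = x∉V p

module Residual {ℓ : Level} (Γ : ConstraintLanguage ℓ) (closed : ClosedUnderBranching Γ)
  {n k : ℕ} (R : Rel k) (R∈Γ : Contains Γ R) (xs : Vec (Fin n) k)
  (V : List (Fin n)) (a : Partial n) (dom : HasDomain V a) where

  ys : List (Fin n)
  ys = newVariables V xs

  f : Partial k
  f = Vec.map (lookup a) xs

  lookup-f : ∀ i → lookup f i ≡ lookup a (lookup xs i)
  lookup-f i = lookup-map i (lookup a) xs

  nothing⇒∉V : ∀ {x} → lookup a x ≡ nothing → x ∉ V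
  nothing⇒∉V {x} eq x∈V with dom x
  ... | inj₁ (_ , _ , eq′) = contradiction (trans (sym eq) eq′) λ ()
  ... | inj₂ (x∉V , _)     = x∉V x∈V

  ∉V⇒nothing : ∀ {x} → x ∉ V → lookup a x ≡ nothing
  ∉V⇒nothing {x} x∉V with dom x
  ... | inj₁ (x∈V , _) = contradiction x∈V x∉V
  ... | inj₂ (_ , eq)  = eq

  member : ∀ i → lookup xs (positions f i) ∈ ys
  member i = ∈-newVariables⁺ V xs (positions f i)
    (nothing⇒∉V (trans (sym (lookup-f (positions f i))) (lookup-positions f i)))

  -- Free positions that hold the same variable receive the same index, so the minor along `g`
  -- identifies repeated variables.
  g : Fin (free f) → Fin (length ys)
  g i = Any.index (member i)

  lookup-g : ∀ i → List.lookup ys (g i) ≡ lookup xs (positions f i)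
  lookup-g i = sym (lookup-index (member i))

  -- A new variable is unassigned in `a`, so `f` leaves its positions in the scope open. `Min`
  -- demands this surjectivity.
  preimage : ∀ j → ∃ λ i → g i ≡ j
  preimage j =
    let (i , eq) , ∉V = ∈-newVariables⁻ V xs (∈-lookup j)
        i′ , eq′ = positions-onto f i (trans (lookup-f i) (trans (cong (lookup a) eq) (∉V⇒nothing ∉V)))
    in i′ , lookup-injective (newVariables-unique V xs)
              (trans (lookup-g i′) (trans (cong (lookup xs) eq′) eq))

  residual : Rel (length ys)
  residual = minor (substitution R f) g

  -- The argument `j` certifies that there is a new variable; its preimage shows that the
  -- substitution leaves an argument, as closure under branching requires.
  residual∈Γ : Fin (length ys) → Contains Γ residual
  residual∈Γ j = Equivalence.to (proj₂ closed residual)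
    ( free f , substitution R f , g , proj₁ closed R f R∈Γ (nonZero-fin (proj₁ (preimage j)))
    , (λ j → let i , eq = preimage j in i , λ { refl → eq }) , λ _ → refl )
    where
    nonZero-fin : ∀ {m} → Fin m → NonZero m
    nonZero-fin {suc _} _ = _

  IsExtension : Partial n → Set
  IsExtension a′ = ∃ λ t → R t ≡ true × Extends a xs t a′

  -- On extensions the default `false` is never reached, since `values` sets all new variables.
  newValues : Partial n → Vec Bool (length ys)
  newValues a′ = tabulate λ j → fromMaybe false (lookup a′ (List.lookup ys j))

  -- Read along `g`, the new values are the undeleted coordinates of `t`; and `t` agrees with `f`
  -- because `a′` extends `a` and carries `t` on the scope.
  newValues∈residual : ∀ {a′} → IsExtension a′ → residual (newValues a′) ≡ true
  newValues∈residual {a′} (t , Rt , ex) =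
    trans (cong (substitution R f) (lookup-ext same)) (substitution⁺ R f t Rt (agrees⁺ f t agr))
    where
    agr : ∀ i {b} → lookup f i ≡ just b → lookup t i ≡ b
    agr i eq = just-injective (trans (sym (values ex i)) (extends ex (trans (sym (lookup-f i)) eq)))
    same : ∀ i → lookup (tabulate λ i → lookup (newValues a′) (g i)) i ≡ lookup (delete f t) i
    same i = begin
      lookup (tabulate λ i → lookup (newValues a′) (g i)) i  ≡⟨ lookup∘tabulate _ i ⟩
      lookup (newValues a′) (g i)                             ≡⟨ lookup∘tabulate _ (g i) ⟩
      fromMaybe false (lookup a′ (List.lookup ys (g i)))      ≡⟨ cong (fromMaybe false ∘ lookup a′) (lookup-g i) ⟩
      fromMaybe false (lookup a′ (lookup xs (positions f i))) ≡⟨ cong (fromMaybe false) (values ex (positions f i)) ⟩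
      lookup t (positions f i)                                ≡⟨ lookup-delete f t i ⟨
      lookup (delete f t) i                                   ∎
      where open ≡-Reasoning

  -- Both extensions have the values of `a` on `V` and are unassigned outside `V` and the scope, so
  -- they can differ only at new variables.
  newValues-injective : ∀ {a₁ a₂} → IsExtension a₁ → IsExtension a₂ → newValues a₁ ≡ newValues a₂ → a₁ ≡ a₂
  newValues-injective {a₁} {a₂} (t₁ , _ , ex₁) (t₂ , _ , ex₂) eq = lookup-ext same
    where
    at : ∀ {x} → x ∈ ys → fromMaybe false (lookup a₁ x) ≡ fromMaybe false (lookup a₂ x)
    at {x} x∈ = begin
      fromMaybe false (lookup a₁ x)                                 ≡⟨ cong (fromMaybe false ∘ lookup a₁) (lookup-index x∈) ⟩
      fromMaybe false (lookup a₁ (List.lookup ys (Any.index x∈)))   ≡⟨ lookup∘tabulate _ (Any.index x∈) ⟨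
      lookup (newValues a₁) (Any.index x∈)                          ≡⟨ cong (λ v → lookup v (Any.index x∈)) eq ⟩
      lookup (newValues a₂) (Any.index x∈)                          ≡⟨ lookup∘tabulate _ (Any.index x∈) ⟩
      fromMaybe false (lookup a₂ (List.lookup ys (Any.index x∈)))   ≡⟨ cong (fromMaybe false ∘ lookup a₂) (lookup-index x∈) ⟨
      fromMaybe false (lookup a₂ x)                                 ∎
      where open ≡-Reasoning
    atNew : ∀ i → lookup xs i ∉ V → lookup a₁ (lookup xs i) ≡ lookup a₂ (lookup xs i)
    atNew i ∉V = trans (values ex₁ i) (trans (cong just t₁≡t₂) (sym (values ex₂ i)))
      where
      -- `fromMaybe false` loses nothing here, as both entries are `just`.
      t₁≡t₂ : lookup t₁ i ≡ lookup t₂ i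
      t₁≡t₂ = subst₂ (λ u v → fromMaybe false u ≡ fromMaybe false v)
                (values ex₁ i) (values ex₂ i) (at (∈-newVariables⁺ V xs i ∉V))
    same : ∀ x → lookup a₁ x ≡ lookup a₂ x
    same x with dom x
    ... | inj₁ (_ , b , eqx) = trans (extends ex₁ eqx) (sym (extends ex₂ eqx))
    ... | inj₂ (x∉V , _) with keeps ex₁ x | keeps ex₂ x
    ...   | inj₂ eq₁        | inj₂ eq₂        = trans eq₁ (sym eq₂)
    ...   | inj₁ (i , refl) | _               = atNew i x∉V
    ...   | inj₂ _          | inj₁ (i , refl) = atNew i x∉V

  module _ {P Q : ℕ} (sparse : UniformlySparse Γ P Q) where

    countExtensions : {as : List (Partial n)} → Unique as → (∀ {a′} → a′ ∈ as → IsExtension a′) →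
                      length as * Q ^ length ys ≤ P ^ length ys
    countExtensions {as} as! ext = bound (length ys) newValues residual (λ j → residual∈Γ j)
        (newValues∈residual ∘ ext) (λ p q → newValues-injective (ext p) (ext q))
      where
      -- The arity is generalised to a variable to allow the case split. For arity 0 all extensions
      -- have the same empty vector of new values, so there is at most one.
      bound : ∀ m (w : Partial n → Vec Bool m) (S : Rel m) → (Fin m → Contains Γ S) →
              (∀ {a′} → a′ ∈ as → S (w a′) ≡ true) →
              (∀ {a₁ a₂} → a₁ ∈ as → a₂ ∈ as → w a₁ ≡ w a₂ → a₁ ≡ a₂) →
              length as * Q ^ m ≤ P ^ m
      bound zero    w S _  _ inj = ≤-trans (≤-reflexive (*-identityʳ _))
        (length-≤-injection w as! (λ _ → ∈-cube _) inj)
      bound (suc m) w S S∈Γ ∈S inj = ≤-trans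
        (*-monoˡ-≤ (Q ^ suc m) (length-≤-injection w as! (∈-tuples⁺ {R = S} ∘ ∈S) inj))
        (sparse S (S∈Γ zero))

-- The iterated join and its invariant

Unique-resp-↭ : {xs ys : List A} → xs ↭ ys → Unique xs → Unique ys
Unique-resp-↭ {A = A} xs↭ys = ↭ₛ.Unique-resp-↭ (setoid A) (↭⇒↭ₛ xs↭ys)

module Join {ℓ : Level} (Γ : ConstraintLanguage ℓ) (closed : ClosedUnderBranching Γ)
  {P Q : ℕ} (Q≤P : Q ≤ P) (sparse : UniformlySparse Γ P Q) {n : ℕ} where

  extensions : Constraint Γ n → Partial n → List (Partial n)
  extensions C a = mapMaybe (merge a (scope C)) (listing C)

  -- Reversed because the program accumulates its results on a stack.
  join : Constraint Γ n → List (Partial n) → List (Partial n)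
  join C L = List.reverse (concatMap (extensions C) L)

  Satisfies : Constraint Γ n → Partial n → Set
  Satisfies C a = ∃ λ t → relation C t ≡ true × ∀ i → lookup a (lookup (scope C) i) ≡ just (lookup t i)

  -- `unique-V` allows comparing `length V` with `n`, and `covers` will make the final assignments
  -- total.
  record Invariant (done : List (Constraint Γ n)) (V : List (Fin n)) (L : List (Partial n)) : Set ℓ where
    field
      unique-V : Unique V
      unique-L : Unique L
      domain   : ∀ {a} → a ∈ L → HasDomain V a
      covers   : ∀ {C} → C ∈ done → ∀ i → lookup (scope C) i ∈ V
      sound    : ∀ {a} → a ∈ L → ∀ {C} → C ∈ done → Satisfies C a
      complete : ∀ m → (∀ {C} → C ∈ done → relation C (Vec.map (lookup m) (scope C)) ≡ true) →
                 ∃ λ a → a ∈ L × a ⊑ m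
      count    : length L * Q ^ length V ≤ P ^ length V

  open Invariant

  invariant-[] : Invariant [] [] (Vec.replicate n nothing ∷ [])
  invariant-[] = record
    { unique-V = []
    ; unique-L = [] ∷ []
    ; domain   = λ { (here refl) x → inj₂ ((λ ()) , lookup-replicate x nothing) }
    ; covers   = λ ()
    ; sound    = λ _ ()
    ; complete = λ m _ → _ , here refl , λ {y} eq → contradiction (trans (sym (lookup-replicate y nothing)) eq) λ ()
    ; count    = ≤-refl
    }

  module _ (C : Constraint Γ n) where

    ∈-extensions⁻ : ∀ {a a′} → a′ ∈ extensions C a →
                    ∃ λ t → relation C t ≡ true × Extends a (scope C) t a′
    ∈-extensions⁻ {a} a′∈ =
      let t , t∈ , eq = ∈-mapMaybe⁻ (merge a (scope C)) (listing C) a′∈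
      in t , ∈-tuples⁻ (∈-resp-↭ (lists C) t∈) , merge-extends a (scope C) t eq

    -- The tuple can be read off the merged assignment along the scope, so distinct tuples give
    -- distinct extensions.
    extensions-unique : ∀ a → Unique (extensions C a)
    extensions-unique a = mapMaybe-unique (merge a (scope C)) injective
      (Unique-resp-↭ (↭-sym (lists C)) (tuples-unique (relation C)))
      where
      injective : ∀ {t₁ t₂ a′} → merge a (scope C) t₁ ≡ just a′ → merge a (scope C) t₂ ≡ just a′ → t₁ ≡ t₂
      injective {t₁} {t₂} eq₁ eq₂ = lookup-ext λ i → just-injective
        (trans (sym (values (merge-extends a (scope C) t₁ eq₁) i)) (values (merge-extends a (scope C) t₂ eq₂) i))

    -- An assignment with domain V is the restriction to V of each of its extensions.
    extensions-disjoint : ∀ {V a₁ a₂ a′} → HasDomain V a₁ → HasDomain V a₂ →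
                          a′ ∈ extensions C a₁ → a′ ∈ extensions C a₂ → a₁ ≡ a₂
    extensions-disjoint {V} {a₁} {a₂} dom₁ dom₂ ∈₁ ∈₂ = lookup-ext same
      where
      ex₁ = proj₂ (proj₂ (∈-extensions⁻ ∈₁))
      ex₂ = proj₂ (proj₂ (∈-extensions⁻ ∈₂))
      same : ∀ x → lookup a₁ x ≡ lookup a₂ x
      same x with dom₁ x | dom₂ x
      ... | inj₁ (_ , _ , eq₁) | inj₁ (_ , _ , eq₂) =
        trans eq₁ (trans (sym (extends ex₁ eq₁)) (trans (extends ex₂ eq₂) (sym eq₂)))
      ... | inj₂ (_ , eq₁) | inj₂ (_ , eq₂) = trans eq₁ (sym eq₂)
      ... | inj₁ (x∈V , _) | inj₂ (x∉V , _) = contradiction x∈V x∉V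
      ... | inj₂ (x∉V , _) | inj₁ (x∈V , _) = contradiction x∈V x∉V

    invariant-∷ : ∀ {done V L} → Invariant done V L →
                  Invariant (C ∷ done) (newVariables V (scope C) ++ V) (join C L)
    invariant-∷ {done} {V} {L} inv = record
      { unique-V = Uniqueₚ.++⁺ (newVariables-unique V (scope C)) (unique-V inv)
                     λ (x∈ , x∈V) → proj₂ (∈-newVariables⁻ V (scope C) x∈) x∈V
      ; unique-L = Unique-resp-↭ (↭-sym (↭-reverse joined))
                     (concatMap-unique (extensions C) L (unique-L inv) (λ {a} _ → extensions-unique a)
                       λ a₁∈ a₂∈ → extensions-disjoint (domain inv a₁∈) (domain inv a₂∈))
      ; domain   = λ a′∈ → let a , a∈ , t , _ , ex = origin a′∈ in merge-domain (scope C) t (domain inv a∈) ex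
      ; covers   = λ { (here refl) i → covered i ; (there C∈) i → ∈ₚ.∈-++⁺ʳ _ (covers inv C∈ i) }
      ; sound    = λ { a′∈ (here refl) → let _ , _ , t , Rt , ex = origin a′∈ in t , Rt , values ex
                     ; a′∈ (there C∈) → let _ , a∈ , _ , _ , ex = origin a′∈
                                            t , Rt , vs = sound inv a∈ C∈
                                        in t , Rt , λ i → extends ex (vs i) }
      ; complete = λ m sat →
          let a , a∈ , a⊑m = complete inv m (sat ∘ there)
              a′ , eq , a′⊑m = merge-complete a (scope C) m a⊑m
              t∈ = ∈-resp-↭ (↭-sym (lists C)) (∈-tuples⁺ (sat (here refl)))
          in a′ , ∈-resp-↭ (↭-sym (↭-reverse joined))
                    (∈ₚ.∈-concatMap⁺ (extensions C) (lose a∈ (∈-mapMaybe⁺ (merge a (scope C)) t∈ eq)))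
                , a′⊑m
      ; count    = bound
      }
      where
      joined = concatMap (extensions C) L
      origin : ∀ {a′} → a′ ∈ join C L →
               ∃ λ a → a ∈ L × ∃ λ t → relation C t ≡ true × Extends a (scope C) t a′
      origin a′∈ =
        let a , a∈ , a′∈a = find (∈ₚ.∈-concatMap⁻ (extensions C) {xs = L} (∈-resp-↭ (↭-reverse joined) a′∈))
        in a , a∈ , ∈-extensions⁻ a′∈a
      covered : ∀ i → lookup (scope C) i ∈ newVariables V (scope C) ++ V
      covered i with lookup (scope C) i ∈? V
        where open DecMembership _≟ᶠ_ using (_∈?_)
      ... | yes x∈V = ∈ₚ.∈-++⁺ʳ _ x∈V
      ... | no x∉V  = ∈ₚ.∈-++⁺ˡ (∈-newVariables⁺ V (scope C) i x∉V)
      ys = newVariables V (scope C)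
      v = length V
      bound : length (join C L) * Q ^ length (ys ++ V) ≤ P ^ length (ys ++ V)
      -- Each old assignment has at most (P / Q) ^ m extensions, where m is `length ys`; multiplying
      -- by the old count adds the exponents.
      bound = begin
        length (join C L) * Q ^ length (ys ++ V)    ≡⟨ cong₂ (λ l e → l * Q ^ e) (↭-length (↭-reverse joined)) (length-++ ys) ⟩
        length joined * Q ^ (length ys + v)         ≡⟨ cong (length joined *_) (^-distribˡ-+-* Q (length ys) v) ⟩
        length joined * (Q ^ length ys * Q ^ v)     ≡⟨ *-assoc (length joined) _ _ ⟨
        length joined * Q ^ length ys * Q ^ v       ≤⟨ *-monoˡ-≤ (Q ^ v) (length-concatMap-≤ (extensions C) L λ {a} a∈ →
                                                         Residual.countExtensions Γ closed (relation C) (allowed C) (scope C) V a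
                                                           (domain inv a∈) sparse (extensions-unique a) ∈-extensions⁻) ⟩
        length L * P ^ length ys * Q ^ v            ≡⟨ cong (_* Q ^ v) (*-comm (length L) _) ⟩
        P ^ length ys * length L * Q ^ v            ≡⟨ *-assoc (P ^ length ys) _ _ ⟩
        P ^ length ys * (length L * Q ^ v)          ≤⟨ *-monoʳ-≤ (P ^ length ys) (count inv) ⟩
        P ^ length ys * P ^ v                       ≡⟨ ^-distribˡ-+-* P (length ys) v ⟨
        P ^ (length ys + v)                         ≡⟨ cong (P ^_) (length-++ ys) ⟨
        P ^ length (ys ++ V)                        ∎
        where open ≤-Reasoning

  -- A list of distinct variables has at most `n` entries, and the missing powers only enlarge the
  -- bound because the base `P / Q` is at least 1. This bounds the list at every stage of the
  -- program.
  count-n : ∀ {done V L} → Invariant done V L → length L * Q ^ n ≤ P ^ n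
  count-n {V = V} {L} inv with injective⇒≤ {f = List.lookup V} (lookup-injective (unique-V inv))
  ... | v≤n = subst (λ e → length L * Q ^ e ≤ P ^ e) (m+[n∸m]≡n v≤n) (begin
    length L * Q ^ (v + (n ∸ v))          ≡⟨ cong (length L *_) (^-distribˡ-+-* Q v _) ⟩
    length L * (Q ^ v * Q ^ (n ∸ v))      ≡⟨ *-assoc (length L) _ _ ⟨
    length L * Q ^ v * Q ^ (n ∸ v)        ≤⟨ *-mono-≤ (count inv) (^-monoˡ-≤ (n ∸ v) Q≤P) ⟩
    P ^ v * P ^ (n ∸ v)                   ≡⟨ ^-distribˡ-+-* P v _ ⟨
    P ^ (v + (n ∸ v))                     ∎)
    where
    open ≤-Reasoning
    v = length V

  total : Partial n → Vec Bool n
  total = Vec.map (fromMaybe false)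

  module _ {φ : Instance Γ n} {done V L} (inv : Invariant done V L)
    (done⁺ : ∀ {C} → C ∈ constraints φ → C ∈ done) (done⁻ : ∀ {C} → C ∈ done → C ∈ constraints φ) where

    lookup-total : ∀ {a} → a ∈ L → ∀ x → lookup a x ≡ just (lookup (total a) x)
    lookup-total {a} a∈ x with domain inv a∈ x
    ... | inj₁ (_ , b , eq) = trans eq (cong just (sym (trans (lookup-map x _ a) (cong (fromMaybe false) eq))))
    ... | inj₂ (x∉V , _) = ⊥-elim (x∉V x∈V)
      where
      x∈V : x ∈ V
      x∈V with C , C∈ , x∈C ← find (occurs φ x) =
        subst (_∈ V) (sym (VecAnyₚ.lookup-index x∈C)) (covers inv (done⁺ C∈) (VecAny.index x∈C))

    models : List (Vec Bool n)
    models = List.map total L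

    models-unique : Unique models
    models-unique = go (unique-L inv) λ a∈ → a∈
      where
      -- The induction runs over sublists of `L` because `total` is known to be injective only on
      -- `L`.
      go : ∀ {K} → Unique K → (∀ {a} → a ∈ K → a ∈ L) → Unique (List.map total K)
      go [] _ = []
      go {a ∷ K} (a∉ ∷ K!) K⊆L = All.tabulate fresh ∷ go K! (K⊆L ∘ there)
        where
        fresh : ∀ {m} → m ∈ List.map total K → total a ≢ m
        fresh m∈ refl with a′ , a′∈ , eq ← ∈ₚ.∈-map⁻ total m∈ =
          All.lookup a∉ a′∈ (lookup-ext λ x →
            trans (lookup-total (K⊆L (here refl)) x)
              (trans (cong (λ m → just (lookup m x)) eq) (sym (lookup-total (K⊆L (there a′∈)) x))))

    models⇒⊨ : ∀ {m} → m ∈ models → m ⊨ φ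
    models⇒⊨ m∈ with a , a∈ , refl ← ∈ₚ.∈-map⁻ total m∈ = All.tabulate λ {C} C∈ →
      let t , Rt , vs = sound inv a∈ (done⁺ C∈)
      in trans (cong (relation C) (lookup-ext λ i →
           trans (lookup-map i _ (scope C)) (just-injective (trans (sym (lookup-total a∈ _)) (vs i))))) Rt

    ⊨⇒models : ∀ {m} → m ⊨ φ → m ∈ models
    ⊨⇒models {m} m⊨φ =
      let a , a∈ , a⊑m = complete inv m (All.lookup m⊨φ ∘ done⁻)
      in subst (_∈ models) (lookup-ext λ x → sym (a⊑m (lookup-total a∈ x))) (∈ₚ.∈-map⁺ total a∈)

-- The program

-- With this code for an unassigned variable, total assignments are already
-- encoded as models; it is recognised by its non-nil head.
encodeMaybe : Maybe Bool → Tree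
encodeMaybe nothing  = (nil ∙ nil) ∙ nil
encodeMaybe (just b) = encodeBool b

encodePartial : Partial n → Tree
encodePartial = encodeVec encodeMaybe

-- The registers: `CS` remaining constraints, also input and output; `OLD` and `NEW` assignments
-- before and after the current constraint; `TS` its remaining tuples; `ASG` the assignment being
-- extended; `SC` and `TUP` what is left of scope and tuple; `POS` and `PRE` for access to an entry
-- of `ASG`; `BAD` the clash flag.
pattern CS  = zero
pattern OLD = suc CS
pattern NEW = suc OLD
pattern TS  = suc NEW
pattern ASG = suc TS
pattern SC  = suc ASG
pattern TUP = suc SC
pattern POS = suc TUP
pattern PRE = suc POS
pattern BAD = suc PRE

descend ascend setEntry bindLoop tupleLoop oldLoop mainLoop initLoop main : Command 10

-- A zipper: lists are accessible only at the front, so the entries before position `POS` are parked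
-- in reverse order in `PRE`, from where `ascend` puts them back.
descend = while var POS loop
  (PRE ≔ cons (hd (var ASG)) (var PRE) ⨾ ASG ≔ tl (var ASG) ⨾ POS ≔ tl (var POS))

ascend = while var PRE loop
  (ASG ≔ cons (hd (var PRE)) (var ASG) ⨾ PRE ≔ tl (var PRE))

-- Emptying `SC` makes `bindLoop` stop at its next test.
clash : Command 10
clash = BAD ≔ cons nil nil ⨾ SC ≔ nil

setEntry =
  if hd (hd (var ASG)) then ASG ≔ cons (hd (var TUP)) (tl (var ASG))
  else if hd (var ASG)
       -- `BAD ≔ nil` serves as the empty command, since `BAD` is still `nil` at this point.
       then if hd (var TUP) then BAD ≔ nil else clash
       else if hd (var TUP) then clash else BAD ≔ nil

bindNext : Command 10
bindNext =
  POS ≔ hd (var SC) ⨾ descend ⨾ setEntry ⨾ ascend ⨾ SC ≔ tl (var SC) ⨾ TUP ≔ tl (var TUP)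

bindLoop = while var SC loop bindNext

tupleLoop = while var TS loop
  ( ASG ≔ hd (var OLD) ⨾ SC ≔ hd (hd (var CS)) ⨾ TUP ≔ hd (var TS) ⨾ BAD ≔ nil ⨾ bindLoop
  ⨾ (if var BAD then BAD ≔ nil else NEW ≔ cons (var ASG) (var NEW)) ⨾ TS ≔ tl (var TS))

oldLoop = while var OLD loop
  (TS ≔ tl (hd (var CS)) ⨾ tupleLoop ⨾ OLD ≔ tl (var OLD))

mainLoop = while var CS loop
  (NEW ≔ nil ⨾ oldLoop ⨾ OLD ≔ var NEW ⨾ CS ≔ tl (var CS))

initLoop = while var POS loop
  (ASG ≔ cons (cons (cons nil nil) nil) (var ASG) ⨾ POS ≔ tl (var POS))

main =
  POS ≔ hd (var CS) ⨾ CS ≔ tl (var CS) ⨾ ASG ≔ nil ⨾ initLoop ⨾ OLD ≔ cons (var ASG) nil ⨾ mainLoop ⨾ CS ≔ var OLD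

-- Running time

Runs : {v : ℕ} → Command v → Store v → Store v → ℕ → Set
Runs C σ τ T = ∃ λ t → (⟨ C , σ ⟩⇓ τ [ t ]) × t ≤ T

store : (cs old new ts asg sc tup pos pre bad : Tree) → Store 10
store cs old new ts asg sc tup pos pre bad =
  cs ∷ old ∷ new ∷ ts ∷ asg ∷ sc ∷ tup ∷ pos ∷ pre ∷ bad ∷ []

module _ {cs old new ts : Tree} where

  descend-runs : ∀ {sc tup bad post} (xs ys : List (Maybe Bool)) →
    ⟨ descend , store cs old new ts (encodeList encodeMaybe (xs ++ post)) sc tup (encodeℕ (length xs)) (encodeList encodeMaybe ys) bad ⟩⇓
      store cs old new ts (encodeList encodeMaybe post) sc tup nil (encodeList encodeMaybe (xs ʳ++ ys)) bad
      [ length xs * 15 + 2 ]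
  descend-runs []       ys = exit refl
  descend-runs (x ∷ xs) ys = again refl (seq assign (seq assign assign)) (descend-runs xs (x ∷ ys))

  ascend-runs : ∀ {sc tup bad} (xs ys : List (Maybe Bool)) →
    ⟨ ascend , store cs old new ts (encodeList encodeMaybe ys) sc tup nil (encodeList encodeMaybe xs) bad ⟩⇓
      store cs old new ts (encodeList encodeMaybe (xs ʳ++ ys)) sc tup nil nil bad
      [ length xs * 11 + 2 ]
  ascend-runs []       ys = exit refl
  ascend-runs (x ∷ xs) ys = again refl (seq assign assign) (ascend-runs xs (x ∷ ys))

  rebuild-runs : ∀ {sc tup bad} (xs ys : List (Maybe Bool)) →
    ⟨ ascend , store cs old new ts (encodeList encodeMaybe ys) sc tup nil (encodeList encodeMaybe (xs ʳ++ [])) bad ⟩⇓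
      store cs old new ts (encodeList encodeMaybe (xs ++ ys)) sc tup nil nil bad
      [ length xs * 11 + 2 ]
  rebuild-runs {sc} {tup} {bad} xs ys with ascend-runs {sc} {tup} {bad} (xs ʳ++ []) ys
  ... | run rewrite ʳ++-ʳ++ xs {[]} {ys} | length-ʳ++ xs {[]} | +-identityʳ (length xs) = run

data Compatible : Maybe Bool → Bool → Set where
  unset : ∀ {b} → Compatible nothing b
  same  : ∀ {b} → Compatible (just b) b

compatible? : ∀ e b → Compatible e b ⊎ e ≡ just (not b)
compatible? nothing      b     = inj₁ unset
compatible? (just true)  true  = inj₁ same
compatible? (just true)  false = inj₂ refl
compatible? (just false) true  = inj₂ refl
compatible? (just false) false = inj₁ same

module _ {cs old new ts post sc tup pre : Tree} where

  -- 17 is the time of the slowest branch, a clash, so that both outcomes share one bound.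
  setEntry-compatible : ∀ {e b} → Compatible e b →
    Runs setEntry (store cs old new ts (encodeMaybe e ∙ post) sc (encodeBool b ∙ tup) nil pre nil)
                  (store cs old new ts (encodeMaybe (just b) ∙ post) sc (encodeBool b ∙ tup) nil pre nil) 17
  setEntry-compatible unset        = _ , if-yes refl assign , m≤m+n 10 7
  setEntry-compatible (same {true}) = _ , if-no refl (if-yes refl (if-yes refl assign)) , m≤m+n 12 5
  setEntry-compatible (same {false}) = _ , if-no refl (if-no refl (if-no refl assign)) , m≤m+n 12 5

  setEntry-clash : ∀ b →
    Runs setEntry (store cs old new ts (encodeMaybe (just (not b)) ∙ post) sc (encodeBool b ∙ tup) nil pre nil)
                  (store cs old new ts (encodeMaybe (just (not b)) ∙ post) nil (encodeBool b ∙ tup) nil pre (nil ∙ nil)) 17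
  setEntry-clash true  = _ , if-no refl (if-no refl (if-yes refl (seq assign assign))) , ≤-refl
  setEntry-clash false = _ , if-no refl (if-yes refl (if-no refl (seq assign assign))) , ≤-refl

-- The zipper view of a vector: the same `before` and `after` serve for the vector and for its
-- updates at `x`.
record Split {A : Set a} (v : Vec A n) (x : Fin n) : Set a where
  field
    before after : List A
    length-before : length before ≡ toℕ x
    toList-v      : Vec.toList v ≡ before ++ lookup v x ∷ after
    toList-update : ∀ y → Vec.toList (v [ x ]≔ y) ≡ before ++ y ∷ after

split : (v : Vec A n) (x : Fin n) → Split v x
split (y ∷ v) zero = record
  { before = [] ; after = Vec.toList v ; length-before = refl ; toList-v = refl ; toList-update = λ _ → refl }
split (y ∷ v) (suc x) = let open Split (split v x) in record
  { before = y ∷ before ; after = after ; length-before = cong suc length-before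
  ; toList-v = cong (y ∷_) toList-v ; toList-update = λ z → cong (y ∷_) (toList-update z) }

-- Each skipped entry costs 15 units in `descend` and 11 in `ascend`; the constant 35 includes the
-- 17 of `setEntry`.
bindTime : ℕ → ℕ
bindTime n = n * 26 + 35

module _ {cs old new ts : Tree} where

  -- The effect of `setEntry` is a parameter, so that success and clash share the navigation.
  bindNext-runs : ∀ {n sc sc′ tup b bad} (xs : List (Maybe Bool)) {e e′ ys} → length xs ≤ n →
    (∀ {pre} → Runs setEntry
      (store cs old new ts (encodeMaybe e ∙ encodeList encodeMaybe ys) (encodeℕ (length xs) ∙ sc) (b ∙ tup) nil pre nil)
      (store cs old new ts (encodeMaybe e′ ∙ encodeList encodeMaybe ys) sc′ (b ∙ tup) nil pre bad) 17) →
    Runs bindNext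
      (store cs old new ts (encodeList encodeMaybe (xs ++ e ∷ ys)) (encodeℕ (length xs) ∙ sc) (b ∙ tup) nil nil nil)
      (store cs old new ts (encodeList encodeMaybe (xs ++ e′ ∷ ys)) (tail sc′) tup nil nil bad) (bindTime n)
  bindNext-runs {n} {tup = tup} {bad = bad} xs {e} {e′} {ys} xs≤n entry =
    let t , run , t≤17 = entry {encodeList encodeMaybe (xs ʳ++ [])} in
    _ , seq assign (seq (descend-runs xs []) (seq run (seq
          (rebuild-runs xs (e′ ∷ ys))
          (seq assign assign)))) ,
    bound t≤17
    where
    bound : ∀ {t} → t ≤ 17 → 4 + suc ((length xs * 15 + 2) + suc (t + suc ((length xs * 11 + 2) + 7))) ≤ bindTime n
    bound t≤ = ≤-trans
      (+-monoʳ-≤ 5 (+-mono-≤ (+-monoˡ-≤ 2 (*-monoˡ-≤ 15 xs≤n))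
        (s≤s (+-mono-≤ t≤ (s≤s (+-monoˡ-≤ 7 (+-monoˡ-≤ 2 (*-monoˡ-≤ 11 xs≤n))))))))
      (≤-reflexive (solve 1 (λ n → con 5 :+ ((n :* con 15 :+ con 2) :+ (con 18 :+ (con 1 :+ ((n :* con 11 :+ con 2) :+ con 7)))) := n :* con 26 :+ con 35) refl n))
      where open +-*-Solver

  bindNext-compatible : ∀ {sc tup} (a : Partial n) x b → Compatible (lookup a x) b →
    Runs bindNext
      (store cs old new ts (encodePartial a) (encodeℕ (toℕ x) ∙ sc) (encodeBool b ∙ tup) nil nil nil)
      (store cs old new ts (encodePartial (a [ x ]≔ just b)) sc tup nil nil nil) (bindTime n)
  bindNext-compatible a x b c
    rewrite Split.toList-v (split a x) | Split.toList-update (split a x) (just b) | sym (Split.length-before (split a x)) =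
      bindNext-runs before (<⇒≤ (subst (_< _) (sym length-before) (toℕ<n x))) (setEntry-compatible c)
    where open Split (split a x)

  bindNext-clash : ∀ {sc tup} (a : Partial n) x b → lookup a x ≡ just (not b) →
    Runs bindNext
      (store cs old new ts (encodePartial a) (encodeℕ (toℕ x) ∙ sc) (encodeBool b ∙ tup) nil nil nil)
      (store cs old new ts (encodePartial a) nil tup nil nil (nil ∙ nil)) (bindTime n)
  bindNext-clash a x b c
    rewrite Split.toList-v (split a x) | sym (Split.length-before (split a x)) | c =
      bindNext-runs before (<⇒≤ (subst (_< _) (sym length-before) (toℕ<n x))) (setEntry-clash b)
    where open Split (split a x)

-- Overwriting an entry by the value it already has changes nothing, which gives all successful
-- cases one form.
bind-compatible : ∀ {e b} (a : Partial n) (x : Fin n) → Compatible e b → lookup a x ≡ e →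
                  bind e a x b ≡ just (a [ x ]≔ just b)
bind-compatible a x unset eq = refl
bind-compatible a x (same {true})  eq = cong just (sym (trans (cong (a [ x ]≔_) (sym eq)) ([]≔-lookup a x)))
bind-compatible a x (same {false}) eq = cong just (sym (trans (cong (a [ x ]≔_) (sym eq)) ([]≔-lookup a x)))

bind-clash : ∀ b (a : Partial n) (x : Fin n) → bind (just (not b)) a x b ≡ nothing
bind-clash true  a x = refl
bind-clash false a x = refl

encodeScope : Vec (Fin n) k → Tree
encodeScope = encodeVec (λ x → encodeℕ (toℕ x))

-- After a clash nothing is said about the assignment register: it may be partly updated, and it is
-- discarded.
Merged : Maybe (Partial n) → Tree → Tree → Set
Merged (just a) asg bad = asg ≡ encodePartial a × bad ≡ nil
Merged nothing  asg bad = bad ≡ nil ∙ nil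

-- Testing a variable takes 2 units, once per iteration and once more on exit.
loopTime : ℕ → ℕ → ℕ
loopTime l T = l * (2 + T) + 2

loop-bound : ∀ {s t T l} → s ≤ T → t ≤ loopTime l T → 2 + (s + t) ≤ loopTime (suc l) T
loop-bound {T = T} s≤ t≤ = s≤s (s≤s (≤-trans (+-mono-≤ s≤ t≤) (≤-reflexive (sym (+-assoc T _ 2)))))

module _ {cs old new ts : Tree} where

  bindLoop-runs : (a : Partial n) (xs : Vec (Fin n) k) (t : Vec Bool k) →
    ∃ λ asg → ∃ λ tup → ∃ λ bad → Merged (merge a xs t) asg bad ×
    Runs bindLoop
      (store cs old new ts (encodePartial a) (encodeScope xs) (encodeVec encodeBool t) nil nil nil)
      (store cs old new ts asg nil tup nil nil bad) (loopTime k (bindTime n))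
  bindLoop-runs a [] [] = _ , _ , _ , (refl , refl) , _ , exit refl , ≤-refl
  bindLoop-runs {n} {suc k} a (x ∷ xs) (b ∷ t) with compatible? (lookup a x) b
  ... | inj₁ c rewrite bind-compatible a x c refl =
    let asg , tup , bad , merged , _ , inner , inner≤ = bindLoop-runs (a [ x ]≔ just b) xs t
        _ , next , next≤ = bindNext-compatible a x b c
    in asg , tup , bad , merged , _ , again refl next inner , loop-bound {l = k} next≤ inner≤
  ... | inj₂ c with bindNext-clash {cs} {old} {new} {ts} {sc = encodeScope xs} {tup = encodeVec encodeBool t} a x b c
  -- `SC` is now `nil`, so the loop exits at once and the remaining iterations of the bound are
  -- slack.
  ...   | _ , next , next≤ rewrite c | bind-clash b a x =
    _ , _ , _ , refl , _ , again refl next (exit refl) , loop-bound {l = k} next≤ (m≤n+m 2 _)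

tupleTime : ℕ → ℕ → ℕ
tupleTime n k = 17 + (loopTime k (bindTime n) + 10)

module _ {cs old : Tree} {n k : ℕ} (a : Partial n) (xs : Vec (Fin n) k) where

  tupleLoop-runs : ∀ {list} (ts : List (Vec Bool k)) (new : List (Partial n)) {asg tup bad} →
    ∃ λ asg′ → ∃ λ tup′ → ∃ λ bad′ →
    Runs tupleLoop
      (store ((encodeScope xs ∙ list) ∙ cs) (encodePartial a ∙ old) (encodeList encodePartial new)
        (encodeList (encodeVec encodeBool) ts) asg nil tup nil nil bad)
      (store ((encodeScope xs ∙ list) ∙ cs) (encodePartial a ∙ old) (encodeList encodePartial (mapMaybe (merge a xs) ts ʳ++ new))
        nil asg′ nil tup′ nil nil bad′)
      (loopTime (length ts) (tupleTime n k))
  tupleLoop-runs [] new = _ , _ , _ , _ , exit refl , ≤-refl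
  tupleLoop-runs {list} (t ∷ ts) new
    with merge a xs t
       | bindLoop-runs {(encodeScope xs ∙ list) ∙ cs} {encodePartial a ∙ old} {encodeList encodePartial new}
                       {encodeList (encodeVec encodeBool) (t ∷ ts)} a xs t
  ... | just a′ | _ , _ , _ , (refl , refl) , _ , inner , inner≤ =
    let _ , _ , _ , _ , rest , rest≤ = tupleLoop-runs ts (a′ ∷ new)
    in _ , _ , _ , _
     , again refl (seq assign (seq assign (seq assign (seq assign (seq inner (seq (if-no refl assign) assign)))))) rest
     , loop-bound {l = length ts} (+-monoʳ-≤ 17 (+-monoˡ-≤ 10 inner≤)) rest≤
  ... | nothing | _ , _ , _ , refl , _ , inner , inner≤ =
    let _ , _ , _ , _ , rest , rest≤ = tupleLoop-runs ts new
    in _ , _ , _ , _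
     , again refl (seq assign (seq assign (seq assign (seq assign (seq inner (seq (if-yes refl assign) assign)))))) rest
     -- Discarding takes 8 units, 2 fewer than pushing a result.
     , loop-bound {l = length ts} (+-monoʳ-≤ 17 (+-mono-≤ inner≤ (m≤m+n 8 2))) rest≤

oldTime : ℕ → ℕ → ℕ → ℕ
oldTime n k l = 6 + (loopTime l (tupleTime n k) + 3)

oldLoop-runs : ∀ {cs} (xs : Vec (Fin n) k) (ts : List (Vec Bool k)) (old new : List (Partial n)) {asg tup bad} →
  ∃ λ asg′ → ∃ λ tup′ → ∃ λ bad′ →
  Runs oldLoop
    (store ((encodeScope xs ∙ encodeList (encodeVec encodeBool) ts) ∙ cs) (encodeList encodePartial old)
      (encodeList encodePartial new) nil asg nil tup nil nil bad)
    (store ((encodeScope xs ∙ encodeList (encodeVec encodeBool) ts) ∙ cs) nil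
      (encodeList encodePartial (concatMap (λ a → mapMaybe (merge a xs) ts) old ʳ++ new)) nil asg′ nil tup′ nil nil bad′)
    (loopTime (length old) (oldTime n k (length ts)))
oldLoop-runs xs ts []        new = _ , _ , _ , _ , exit refl , ≤-refl
oldLoop-runs xs ts (a ∷ old) new
  -- Pushing a concatenation onto the stack is pushing its two parts in turn.
  rewrite ++-ʳ++ (mapMaybe (merge a xs) ts) {concatMap (λ a → mapMaybe (merge a xs) ts) old} {new} =
    let _ , _ , _ , _ , inner , inner≤ = tupleLoop-runs a xs ts new
        _ , _ , _ , _ , rest , rest≤ = oldLoop-runs xs ts old (mapMaybe (merge a xs) ts ʳ++ new)
    in _ , _ , _ , _ , again refl (seq assign (seq inner assign)) rest
     , loop-bound {l = length old} (+-monoʳ-≤ 6 (+-monoˡ-≤ 3 inner≤)) rest≤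

-- The final length `l` is fixed by an equation, so that the induction changes the equation and not
-- the length of the final vector.
initLoop-runs : ∀ {cs old new ts sc tup pre bad} m n {l} → n + m ≡ l →
  ⟨ initLoop , store cs old new ts (encodePartial (Vec.replicate m nothing)) sc tup (encodeℕ n) pre bad ⟩⇓
    store cs old new ts (encodePartial (Vec.replicate l nothing)) sc tup nil pre bad [ n * 14 + 2 ]
initLoop-runs m zero    refl = exit refl
initLoop-runs m (suc n) eq   = again refl (seq assign assign) (initLoop-runs (suc m) n (trans (+-suc n m) eq))

-- Polynomial time bounds

oldTime-mono : ∀ {n k l s} → n ≤ s → k ≤ s → l ≤ s → oldTime n k l ≤ oldTime s s s
oldTime-mono n≤ k≤ l≤ =
  +-monoʳ-≤ 6 (+-monoˡ-≤ 3 (loopTime-mono l≤ (+-monoʳ-≤ 17 (+-monoˡ-≤ 10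
    (loopTime-mono k≤ (+-monoˡ-≤ 35 (*-monoˡ-≤ 26 n≤)))))))
  where
  loopTime-mono : ∀ {l l′ T T′} → l ≤ l′ → T ≤ T′ → loopTime l T ≤ loopTime l′ T′
  loopTime-mono l≤ T≤ = +-monoˡ-≤ 2 (*-mono-≤ l≤ (+-monoʳ-≤ 2 T≤))

-- Here and in total-quartic the two sides differ by an explicit polynomial in r = s ∸ 1
-- with nonnegative coefficients.
oldTime-cubic : ∀ s → 1 ≤ s → 2 + oldTime s s s ≤ 107 * s ^ 3
oldTime-cubic (suc r) _ = m+n≤o⇒m≤o _ (≤-reflexive
  (solve 1 (λ r → let s = con 1 :+ r in
      con 2 :+ (con 6 :+ ((s :* (con 2 :+ (con 17 :+ ((s :* (con 2 :+ (s :* con 26 :+ con 35)) :+ con 2) :+ con 10))) :+ con 2) :+ con 3))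
        :+ (con 138 :* r :+ con 206 :* r :^ 2 :+ con 81 :* r :^ 3)
      := con 107 :* s :^ 3) refl r))
  where open +-*-Solver

total-quartic : ∀ s → 1 ≤ s → 14 * s + 22 + (s * (107 * s ^ 3 + 14) + 2) ≤ 159 * s ^ 4
total-quartic (suc r) _ = m+n≤o⇒m≤o _ (≤-reflexive
  (solve 1 (λ r → let s = con 1 :+ r in
      (con 14 :* s :+ con 22 :+ (s :* (con 107 :* s :^ 3 :+ con 14) :+ con 2))
        :+ (con 180 :* r :+ con 312 :* r :^ 2 :+ con 208 :* r :^ 3 :+ con 52 :* r :^ 4)
      := con 159 :* s :^ 4) refl r))
  where open +-*-Solver

-- One round takes at most `l * M + 14` units. Only the list length `l` is exponential, and
-- `l * q ≤ p` absorbs it into the power `p`; the constant part uses `q ≤ p`.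
main-bound : ∀ {o t l c M q p} → o ≤ l * M + 2 → l * q ≤ p → q ≤ p → t * q ≤ (c * (M + 14) + 2) * p →
             (2 + ((4 + (o + 6)) + t)) * q ≤ (suc c * (M + 14) + 2) * p
main-bound {o} {t} {l} {c} {M} {q} {p} o≤ lq≤p q≤p tq≤ = begin
  (2 + ((4 + (o + 6)) + t)) * q            ≤⟨ *-monoˡ-≤ q (+-monoʳ-≤ 2 (+-monoˡ-≤ t (+-monoʳ-≤ 4 (+-monoˡ-≤ 6 o≤)))) ⟩
  (2 + ((4 + ((l * M + 2) + 6)) + t)) * q  ≡⟨ solve 4 (λ l M t q → (con 2 :+ ((con 4 :+ ((l :* M :+ con 2) :+ con 6)) :+ t)) :* q
                                                := l :* q :* M :+ con 14 :* q :+ t :* q) refl l M t q ⟩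
  l * q * M + 14 * q + t * q               ≤⟨ +-mono-≤ (+-mono-≤ (*-monoˡ-≤ M lq≤p) (*-monoʳ-≤ 14 q≤p)) tq≤ ⟩
  p * M + 14 * p + (c * (M + 14) + 2) * p  ≡⟨ solve 3 (λ p M c → p :* M :+ con 14 :* p :+ (c :* (M :+ con 14) :+ con 2) :* p
                                                := ((con 1 :+ c) :* (M :+ con 14) :+ con 2) :* p) refl p M c ⟩
  (suc c * (M + 14) + 2) * p               ∎
  where
  open ≤-Reasoning
  open +-*-Solver

-- Sizes and changes of encoding

length≤size : (e : A → Tree) (xs : List A) → length xs ≤ size (encodeList e xs)
length≤size e []       = z≤n
length≤size e (x ∷ xs) = s≤s (≤-trans (length≤size e xs) (m≤n+m _ (size (e x))))

∈⇒size≤ : (e : A → Tree) {xs : List A} {x : A} → x ∈ xs → size (e x) ≤ size (encodeList e xs)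
∈⇒size≤ e (here refl) = ≤-trans (m≤m+n _ _) (n≤1+n _)
∈⇒size≤ e (there x∈)  = ≤-trans (∈⇒size≤ e x∈) (≤-trans (m≤n+m _ _) (n≤1+n _))

n≤size : ∀ n → n ≤ size (encodeℕ n)
n≤size zero    = z≤n
n≤size (suc n) = s≤s (≤-trans (n≤size n) (n≤1+n _))

1≤size : ∀ t → 1 ≤ size t
1≤size nil     = s≤s z≤n
1≤size (_ ∙ _) = s≤s z≤n

encodePartial-just : (m : Vec Bool n) → encodePartial (Vec.map just m) ≡ encodeVec encodeBool m
encodePartial-just []      = refl
encodePartial-just (b ∷ m) = cong (encodeBool b ∙_) (encodePartial-just m)

encodeList-map : ∀ {b} {B : Set b} {e : A → Tree} {e′ : B → Tree} {f : A → B} (xs : List A) →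
                 (∀ {x} → x ∈ xs → e x ≡ e′ (f x)) → encodeList e xs ≡ encodeList e′ (List.map f xs)
encodeList-map []       _ = refl
encodeList-map (x ∷ xs) h = cong₂ _∙_ (h (here refl)) (encodeList-map xs (h ∘ there))

-- Correctness and total running time of the program

module Correctness {ℓ : Level} (Γ : ConstraintLanguage ℓ) (closed : ClosedUnderBranching Γ)
  {P Q : ℕ} (Q≤P : Q ≤ P) (sparse : UniformlySparse Γ P Q) {n : ℕ} where

  open Join Γ closed Q≤P sparse {n}

  module _ (s : ℕ) (1≤s : 1 ≤ s) (n≤s : n ≤ s) where

    mainLoop-runs : (cs : List (Constraint Γ n)) →
      (∀ {C} → C ∈ cs → arity C ≤ s × length (listing C) ≤ s) →
      ∀ {done V L} → Invariant done V L → ∀ {new asg tup bad} →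
      ∃ λ V′ → ∃ λ L′ → Invariant (cs ʳ++ done) V′ L′ ×
      ∃ λ new′ → ∃ λ asg′ → ∃ λ tup′ → ∃ λ bad′ → ∃ λ t →
      (⟨ mainLoop , store (encodeList encodeConstraint cs) (encodeList encodePartial L) new nil asg nil tup nil nil bad ⟩⇓
        store nil (encodeList encodePartial L′) new′ nil asg′ nil tup′ nil nil bad′ [ t ]) ×
      t * Q ^ n ≤ (length cs * (107 * s ^ 3 + 14) + 2) * P ^ n
    mainLoop-runs []       _    inv =
      _ , _ , inv , _ , _ , _ , _ , _ , exit refl , *-monoʳ-≤ 2 (^-monoˡ-≤ n Q≤P)
    mainLoop-runs (C ∷ cs) size≤ {L = L} inv =
      let k≤s , l≤s = size≤ (here refl)
          _ , _ , _ , _ , old , old≤ = oldLoop-runs (scope C) (listing C) L []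
          V′ , L′ , inv′ , _ , _ , _ , _ , _ , rest , rest≤ = mainLoop-runs cs (size≤ ∘ there) (invariant-∷ C inv)
      in V′ , L′ , inv′ , _ , _ , _ , _ , _
       , again refl (seq assign (seq old (seq assign assign))) rest
       -- The cost of a round is governed by the list before it, so `count-n` is applied to `inv`
       -- and not to the new invariant.
       , main-bound {l = length L} {c = length cs} {M = 107 * s ^ 3}
           (≤-trans old≤ (+-monoˡ-≤ 2 (*-monoʳ-≤ (length L)
             (≤-trans (+-monoʳ-≤ 2 (oldTime-mono n≤s k≤s l≤s)) (oldTime-cubic s 1≤s)))))
           (count-n inv) (^-monoˡ-≤ n Q≤P) rest≤

  enumerate : (φ : Instance Γ n) →
    Σ (List (Vec Bool n)) λ ms → Σ ℕ λ t →
      Unique ms × (∀ m → m ∈ ms ⇔ m ⊨ φ) ×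
      Computes program main from encodeInstance φ to encodeModels ms inTime t ×
      t * Q ^ n ≤ 159 * size (encodeInstance φ) ^ 4 * P ^ n
  enumerate φ =
    let V , L , inv , _ , _ , _ , _ , t , run , t≤ = mainLoop-runs s 1≤s n≤s cs size≤ invariant-[]
        -- The treated constraints end up in reverse order; only membership matters.
        done⁺ = λ {C} (C∈ : C ∈ cs) → reverseAcc⁺ [] cs (inj₂ C∈)
        done⁻ = λ {C} (C∈ : C ∈ cs ʳ++ []) → fromInj₂ (λ ()) (reverseAcc⁻ [] cs C∈)
    in models {φ} inv done⁺ done⁻
     , 4 + (4 + (3 + suc ((n * 14 + 2) + (5 + suc (t + 2)))))
     , models-unique {φ} inv done⁺ done⁻
     , (λ m → mk⇔ (models⇒⊨ {φ} inv done⁺ done⁻) (⊨⇒models {φ} inv done⁺ done⁻))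
     , (_ , seq assign (seq assign (seq assign (seq (initLoop-runs 0 n (+-identityʳ n)) (seq assign (seq run assign)))))
          , encodeList-map L λ {a} a∈ → trans
              (cong encodePartial (lookup-ext λ x → trans (lookup-total {φ} inv done⁺ done⁻ a∈ x) (sym (lookup-map x just (total a)))))
              (encodePartial-just (total a)))
     , bound t t≤
    where
    cs = constraints φ
    s  = size (encodeInstance φ)
    1≤s = 1≤size (encodeInstance φ)
    n≤s : n ≤ s
    n≤s = ≤-trans (n≤size n) (≤-trans (m≤m+n _ _) (n≤1+n _))
    cs≤s : size (encodeList encodeConstraint cs) ≤ s
    cs≤s = ≤-trans (m≤n+m _ (size (encodeℕ n))) (n≤1+n _)
    length≤s : length cs ≤ s
    length≤s = ≤-trans (length≤size encodeConstraint cs) cs≤s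
    size≤ : ∀ {C} → C ∈ cs → arity C ≤ s × length (listing C) ≤ s
    size≤ {C} C∈ =
        ≤-trans (subst (_≤ size scopeCode) (length-toList (scope C)) (length≤size _ (Vec.toList (scope C))))
          (≤-trans (≤-trans (m≤m+n _ (size listCode)) (n≤1+n _)) code≤s)
      , ≤-trans (length≤size _ (listing C)) (≤-trans (≤-trans (m≤n+m _ (size scopeCode)) (n≤1+n _)) code≤s)
      where
      scopeCode = encodeScope (scope C)
      listCode  = encodeList (encodeVec encodeBool) (listing C)
      code≤s : size (encodeConstraint C) ≤ s
      code≤s = ≤-trans (∈⇒size≤ encodeConstraint C∈) cs≤s
    bound : ∀ t → t * Q ^ n ≤ (length cs * (107 * s ^ 3 + 14) + 2) * P ^ n →
            (4 + (4 + (3 + suc ((n * 14 + 2) + (5 + suc (t + 2)))))) * Q ^ n ≤ 159 * s ^ 4 * P ^ n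
    bound t t≤ = begin
      (4 + (4 + (3 + suc ((n * 14 + 2) + (5 + suc (t + 2)))))) * Q ^ n
        ≡⟨ solve 3 (λ n t q → (con 4 :+ (con 4 :+ (con 3 :+ (con 1 :+ ((n :* con 14 :+ con 2) :+ (con 5 :+ (con 1 :+ (t :+ con 2)))))))) :* q
              := (con 14 :* n :+ con 22) :* q :+ t :* q) refl n t (Q ^ n) ⟩
      (14 * n + 22) * Q ^ n + t * Q ^ n
        ≤⟨ +-mono-≤ (*-mono-≤ (+-monoˡ-≤ 22 (*-monoʳ-≤ 14 n≤s)) (^-monoˡ-≤ n Q≤P))
             (≤-trans t≤ (*-monoˡ-≤ (P ^ n) (+-monoˡ-≤ 2 (*-monoˡ-≤ (107 * s ^ 3 + 14) length≤s)))) ⟩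
      (14 * s + 22) * P ^ n + (s * (107 * s ^ 3 + 14) + 2) * P ^ n
        ≡⟨ *-distribʳ-+ (P ^ n) (14 * s + 22) _ ⟨
      (14 * s + 22 + (s * (107 * s ^ 3 + 14) + 2)) * P ^ n
        ≤⟨ *-monoˡ-≤ (P ^ n) (total-quartic s 1≤s) ⟩
      159 * s ^ 4 * P ^ n ∎
      where
      open ≤-Reasoning
      open +-*-Solver

theorem15 : {ℓ : Level} (Γ : ConstraintLanguage ℓ) →
    AsymptoticallySparse Γ →
    ClosedUnderBranching Γ →
    OnlyNonTrivial Γ →
    SparselyEnumerable Γ
theorem15 Γ asymptoticallySparse closed nonTrivial =
  let P , Q , P<2Q , Q≤P , sparse = uniformlySparse Γ asymptoticallySparse nonTrivial
  -- 159 is the value of the left side of `total-quartic` at `s = 1`.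
  in P , Q , P<2Q , program main , 159 , 4 , Correctness.enumerate Γ closed Q≤P sparse
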